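{- For every integer $d\ge 3$, there exist infinitely many triangulations $K$ of the $d$-simplex $\Delta^d$ such that the graph $G_K$ is not $(d+2)$-critical.
   Context: A triangulation of the $d$-simplex $\Delta^d$ (with vertices $v_1,\dots,v_{d+1}$) is a finite geometric simplicial complex $K$ whose union of simplices is $\Delta^d$; the vertices $v_1,\dots,v_{d+1}$ are vertices of $K$. The graph $G_K$ has vertex set consisting of: (V1) the vertices $u_1,\dots,u_n$ of $K$; (V2) a vertex $v_\rho$ for each $d$-simplex $\rho$ of $K$; (V3) a vertex $w_\tau$ for each $(d-1)$-dimensional face $\tau$ of $\Delta^d$. Its edges are: $u_iv_\rho$ whenever $u_i$ is a vertex of $\rho$; $u_iw_\tau$ whenever $u_i$ lies in the $(d-1)$-face $\tau$ of $\Delta^d$; and $w_\tau w_{\tau'}$ for every pair of distinct $(d-1)$-faces $\tau,\tau'$ of $\Delta^d$. A graph is $k$-chromatic if its chromatic number is $k$, and $k$-critical if it is $k$-chromatic and deleting any edge yields a $(k-1)$-colourable graph.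
   Formalization: Triangulations have vertices with rational barycentric coordinates, and the conditions that the simplices are non-degenerate, cover the d-simplex and meet in common faces are stated over rational points and coefficients only, instead of real ones. -}

module Defs where

open import Data.Nat using (ℕ; zero; suc; _<_)
open import Data.Fin using (Fin; zero; suc)
open import Data.Rational using (ℚ; 0ℚ; 1ℚ; _+_; _*_; _≤_)
open import Data.Product using (Σ; ∃; _×_; _,_)
open import Data.Sum using (_⊎_; inj₁; inj₂)
open import Data.Empty using (⊥)
open import Relation.Nullary using (¬_)
open import Relation.Binary.PropositionalEquality using (_≡_; _≢_)

Σℚ : ∀ {k} → (Fin k → ℚ) → ℚ
Σℚ {zero}  f = 0ℚ
Σℚ {suc k} f = f zero + Σℚ (λ i → f (suc i))

-- Geometry.  A point is given by its d+1 barycentric coordinates w.r.t.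
-- the vertices v_1..v_{d+1} of Δ^d (i.e. a point of ℚ^{d+1}); Δ^d is the
-- standard simplex {x | x_j ≥ 0, Σ x_j = 1} in ℚ^{d+1}.

Point : ℕ → Set
Point d = Fin (suc d) → ℚ

_≐_ : ∀ {d} → Point d → Point d → Set
x ≐ y = ∀ j → x j ≡ y j

InDelta : (d : ℕ) → Point d → Set
InDelta d x = (∀ j → 0ℚ ≤ x j) × Σℚ x ≡ 1ℚ

corner : ∀ {d} → Fin (suc d) → Point d
corner j k with Data.Fin._≟_ j k
... | Relation.Nullary.yes _ = 1ℚ
... | Relation.Nullary.no  _ = 0ℚ

comb : ∀ {d} → (Fin (suc d) → ℚ) → (Fin (suc d) → Point d) → Point d
comb λs p j = Σℚ (λ k → λs k * p k j)

Convex : ∀ {d} → (Fin (suc d) → ℚ) → Set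
Convex λs = (∀ k → 0ℚ ≤ λs k) × Σℚ λs ≡ 1ℚ

InConv : ∀ {d} → (Fin (suc d) → Point d) → Point d → Set
InConv p x = ∃ λ λs → Convex λs × (comb λs p ≐ x)

AffIndep : ∀ {d} → (Fin (suc d) → Point d) → Set
AffIndep p = ∀ λs → Σℚ λs ≡ 0ℚ → (∀ j → comb λs p j ≡ 0ℚ) → ∀ k → λs k ≡ 0ℚ

-- A (rational) triangulation of Δ^d, given by its vertices u_1..u_n and
-- its d-simplices (facets) ρ_1..ρ_m; K is the complex consisting of the
-- facets and all their faces.

record Triangulation (d : ℕ) : Set where
  field
    n      : ℕ
    m      : ℕ
    vert   : Fin n → Point d
    facet  : Fin m → Fin (suc d) → Fin n
    vert-in    : ∀ i → InDelta d (vert i)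
    vert-inj   : ∀ i i' → vert i ≐ vert i' → i ≡ i'
    vert-used  : ∀ i → ∃ λ r → ∃ λ k → facet r k ≡ i
    corners    : ∀ j → ∃ λ i → vert i ≐ corner j
    facet-indep : ∀ r → AffIndep (λ k → vert (facet r k))
    facet-distinct : ∀ r s → (∀ k → ∃ λ l → facet r k ≡ facet s l) → r ≡ s
    facet-meet : ∀ r s x →
      InConv (λ k → vert (facet r k)) x →
      InConv (λ k → vert (facet s k)) x →
      ∃ λ λs → Convex λs × (comb λs (λ k → vert (facet r k)) ≐ x)
             × (∀ k → λs k ≢ 0ℚ → ∃ λ l → facet r k ≡ facet s l)
    cover : ∀ x → InDelta d x → ∃ λ r → InConv (λ k → vert (facet r k)) x

record Graph : Set₁ where
  field
    V   : Set
    Adj : V → V → Set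

open Graph public

Colourable : Graph → ℕ → Set
Colourable G k = ∃ λ (c : V G → Fin k) → ∀ x y → Adj G x y → c x ≢ c y

Chromatic : Graph → ℕ → Set
Chromatic G k = Colourable G k × (∀ j → j < k → ¬ Colourable G j)

deleteEdge : (G : Graph) → V G → V G → Graph
deleteEdge G a b = record
  { V = V G
  ; Adj = λ x y → Adj G x y × ¬ ((x ≡ a × y ≡ b) ⊎ (x ≡ b × y ≡ a)) }

Critical : Graph → ℕ → Set
Critical G k = Chromatic G k ×
  (∀ a b → Adj G a b → Colourable (deleteEdge G a b) (Data.Nat._∸_ k 1))

module _ {d : ℕ} (K : Triangulation d) where
  open Triangulation K

  -- inj₁ i : u_i ;  inj₂ (inj₁ r) : v_ρ ;  inj₂ (inj₂ j) : w_τ for the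
  -- facet τ_j = {x_j = 0} of Δ^d (opposite the corner v_j)
  GV : Set
  GV = Fin n ⊎ (Fin m ⊎ Fin (suc d))

  GAdj : GV → GV → Set
  GAdj (inj₁ i) (inj₂ (inj₁ r)) = ∃ λ k → facet r k ≡ i
  GAdj (inj₂ (inj₁ r)) (inj₁ i) = ∃ λ k → facet r k ≡ i
  GAdj (inj₁ i) (inj₂ (inj₂ j)) = vert i j ≡ 0ℚ
  GAdj (inj₂ (inj₂ j)) (inj₁ i) = vert i j ≡ 0ℚ
  GAdj (inj₂ (inj₂ j)) (inj₂ (inj₂ j')) = j ≢ j'
  GAdj _ _ = ⊥

  G[_] : Graph
  G[_] = record { V = GV ; Adj = GAdj }

{-# OPTIONS --safe #-}

-- Deleting the edge between a vertex u of a facet r and v_r turns (d+1)-colourings of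
-- G_K into Sperner colourings of K in which no facet other than r is rainbow. So it
-- suffices to find K with a facet that is never the only rainbow facet of a Sperner
-- colouring. This property of (K , r) survives coning K with a new apex, which raises d,
-- and subdividing another facet at its barycentre, which adds a vertex. For d = 3, remove
-- one facet from a neighbourly 8-vertex triangulation of the 3-sphere and realise the
-- rest in Δ³ with four interior vertices: the tetrahedron on the interior vertices works.

module Submission where

open import Defs
open import Data.Nat using (ℕ; zero; suc; _≤_; _+_; _∸_; z≤n; s≤s)
open import Data.Product using (∃; _×_; _,_; proj₁; proj₂)
open import Relation.Nullary using (¬_; Dec; yes; no; contradiction)
open import Data.Fin using (Fin; zero; suc; _≟_; _↑ˡ_; #_; splitAt; join; punchOut)
open import Data.Fin.Patterns
import Data.Fin.Properties as Fin
open import Data.Integer as ℤ using (ℤ; +_; 0ℤ; 1ℤ)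
import Data.Integer.Properties as ℤ
open import Data.List using (List; []; _∷_)
open import Data.List.Relation.Unary.All as All using (All; []; _∷_)
import Data.Nat as ℕ
import Data.Nat.Properties as ℕ
open import Data.Rational as ℚ using (ℚ; 0ℚ; 1ℚ)
import Data.Rational.Properties as ℚ
open import Data.Rational.Solver using (module +-*-Solver)
import Data.Rational.Unnormalised as ℚᵘ
import Data.Rational.Unnormalised.Properties as ℚᵘ
open import Data.Sum using (_⊎_; inj₁; inj₂; [_,_]′)
open import Data.Unit using (tt)
open import Data.Vec as Vec using (Vec; []; _∷_; lookup; tabulate)
import Data.Vec.Properties as Vec
open import Function using (_∘_; const)
open import Relation.Binary.PropositionalEquality
open import Relation.Nullary.Decidable
  using (toWitness; decidable-stable; _×-dec_; _⊎-dec_; _→-dec_; ¬?)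

-- Sperner's lemma puts a rainbow facet into every Sperner colouring, which is why `G_K` needs d+2
-- colours. Criticality asks for the opposite extreme at every facet: a Sperner colouring in which
-- that facet is the only rainbow one. A single facet that refuses this is enough. The main obstacle
-- is geometric: each complex must be shown to be a triangulation. A statement about points of the
-- simplex alone does not pass to a cone, because without the apex coordinate the others need not
-- sum to 1. Hence `Fan` speaks of all nonnegative points and of weights that are not normalised.
-- Its field `meet` also says that the weights at a shared vertex agree; this uniqueness carries the
-- subdivision step. For the base, the geometry is reduced to integer certificates: a separating
-- functional for each ordered pair of facets proves that they meet properly, and a decision tree
-- that locates every point proves that they cover.

private
  variable
    d n m k : ℕ

-- Finite sums of rationals

Σ-cong : {f g : Fin k → ℚ} → (∀ i → f i ≡ g i) → Σℚ f ≡ Σℚ g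
Σ-cong {k = zero}  eq = refl
Σ-cong {k = suc _} eq = cong₂ ℚ._+_ (eq zero) (Σ-cong (eq ∘ suc))

Σ-zero : ∀ k → Σℚ {k} (const 0ℚ) ≡ 0ℚ
Σ-zero zero    = refl
Σ-zero (suc k) = trans (ℚ.+-identityˡ _) (Σ-zero k)

Σ-0s : {f : Fin k → ℚ} → (∀ i → f i ≡ 0ℚ) → Σℚ f ≡ 0ℚ
Σ-0s {k} eq = trans (Σ-cong eq) (Σ-zero k)

Σ-+ : (f g : Fin k → ℚ) → Σℚ (λ i → f i ℚ.+ g i) ≡ Σℚ f ℚ.+ Σℚ g
Σ-+ {zero}  f g = refl
Σ-+ {suc _} f g rewrite Σ-+ (f ∘ suc) (g ∘ suc) =
  solve 4 (λ a b c e → (a :+ b) :+ (c :+ e) := (a :+ c) :+ (b :+ e)) refl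
    (f zero) (g zero) (Σℚ (f ∘ suc)) (Σℚ (g ∘ suc))
  where open +-*-Solver

Σ-*ˡ : (c : ℚ) (f : Fin k → ℚ) → Σℚ (λ i → c ℚ.* f i) ≡ c ℚ.* Σℚ f
Σ-*ˡ {zero}  c f = sym (ℚ.*-zeroʳ c)
Σ-*ˡ {suc _} c f = trans (cong (c ℚ.* f zero ℚ.+_) (Σ-*ˡ c (f ∘ suc)))
                         (sym (ℚ.*-distribˡ-+ c (f zero) _))

Σ-*ʳ : (f : Fin k → ℚ) (c : ℚ) → Σℚ (λ i → f i ℚ.* c) ≡ Σℚ f ℚ.* c
Σ-*ʳ f c = trans (Σ-cong (λ i → ℚ.*-comm (f i) c)) (trans (Σ-*ˡ c f) (ℚ.*-comm c _))

Σ-swap : (f : Fin k → Fin n → ℚ) →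
  Σℚ (λ i → Σℚ (f i)) ≡ Σℚ (λ j → Σℚ (λ i → f i j))
Σ-swap {zero}  {n} f = sym (Σ-zero n)
Σ-swap {suc _} {n} f = trans (cong (Σℚ (f zero) ℚ.+_) (Σ-swap (f ∘ suc)))
                             (sym (Σ-+ (f zero) _))

Σ-nonneg : {f : Fin k → ℚ} → (∀ i → 0ℚ ℚ.≤ f i) → 0ℚ ℚ.≤ Σℚ f
Σ-nonneg {zero}  f≥0 = ℚ.≤-refl
Σ-nonneg {suc _} f≥0 = ℚ.+-mono-≤ (f≥0 zero) (Σ-nonneg (f≥0 ∘ suc))

Σ-nonpos : {f : Fin k → ℚ} → (∀ i → f i ℚ.≤ 0ℚ) → Σℚ f ℚ.≤ 0ℚ
Σ-nonpos {zero}  f≤0 = ℚ.≤-refl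
Σ-nonpos {suc _} f≤0 = ℚ.+-mono-≤ (f≤0 zero) (Σ-nonpos (f≤0 ∘ suc))

term≤Σ : {f : Fin k → ℚ} → (∀ i → 0ℚ ℚ.≤ f i) → ∀ i → f i ℚ.≤ Σℚ f
term≤Σ {f = f} f≥0 zero    = subst (ℚ._≤ Σℚ f) (ℚ.+-identityʳ _)
  (ℚ.+-mono-≤ (ℚ.≤-refl {f zero}) (Σ-nonneg (f≥0 ∘ suc)))
term≤Σ {f = f} f≥0 (suc i) = subst (ℚ._≤ Σℚ f) (ℚ.+-identityˡ _)
  (ℚ.+-mono-≤ (f≥0 zero) (term≤Σ (f≥0 ∘ suc) i))

-- The entry is set to zero instead of deleted, so that `stack` can compare weights on an old and a
-- new facet over one index set.
dropAt : Fin k → (Fin k → ℚ) → Fin k → ℚ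
dropAt j f i with i ≟ j
... | yes _ = 0ℚ
... | no  _ = f i

dropAt-same : (j : Fin k) (f : Fin k → ℚ) → dropAt j f j ≡ 0ℚ
dropAt-same j f with j ≟ j
... | yes _  = refl
... | no j≢j = contradiction refl j≢j

dropAt-other : {i j : Fin k} (f : Fin k → ℚ) → i ≢ j → dropAt j f i ≡ f i
dropAt-other {i = i} {j} f i≢j with i ≟ j
... | yes i≡j = contradiction i≡j i≢j
... | no _    = refl

dropAt-suc : (j : Fin k) (f : Fin (suc k) → ℚ) (i : Fin k) →
  dropAt (suc j) f (suc i) ≡ dropAt j (f ∘ suc) i
dropAt-suc j f i with i ≟ j
... | yes _ = refl
... | no _  = refl

Σ-extract : (j : Fin k) (f : Fin k → ℚ) → Σℚ f ≡ f j ℚ.+ Σℚ (dropAt j f)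
Σ-extract zero f = cong (f zero ℚ.+_)
  (sym (trans (ℚ.+-identityˡ _) (Σ-cong (λ i → dropAt-other {i = suc i} {zero} f λ ()))))
Σ-extract (suc j) f = begin
  f zero ℚ.+ Σℚ (f ∘ suc)
    ≡⟨ cong (f zero ℚ.+_) (Σ-extract j (f ∘ suc)) ⟩
  f zero ℚ.+ (f (suc j) ℚ.+ Σℚ (dropAt j (f ∘ suc)))
    ≡⟨ solve 3 (λ a b c → a :+ (b :+ c) := b :+ (a :+ c)) refl (f zero) (f (suc j)) _ ⟩
  f (suc j) ℚ.+ (f zero ℚ.+ Σℚ (dropAt j (f ∘ suc)))
    ≡⟨ cong (λ s → f (suc j) ℚ.+ (f zero ℚ.+ s)) (Σ-cong (sym ∘ dropAt-suc j f)) ⟩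
  f (suc j) ℚ.+ Σℚ (dropAt (suc j) f) ∎
  where open ≡-Reasoning; open +-*-Solver

Σ-single : (j : Fin k) (f : Fin k → ℚ) → (∀ i → i ≢ j → f i ≡ 0ℚ) → Σℚ f ≡ f j
Σ-single j f vanish = trans (Σ-extract j f)
  (trans (cong (f j ℚ.+_) (Σ-0s rest)) (ℚ.+-identityʳ _))
  where
  rest : ∀ i → dropAt j f i ≡ 0ℚ
  rest i with i ≟ j
  ... | yes _  = refl
  ... | no i≢j = vanish i i≢j

*-nonneg : {p q : ℚ} → 0ℚ ℚ.≤ p → 0ℚ ℚ.≤ q → 0ℚ ℚ.≤ p ℚ.* q
*-nonneg {p} {q} p≥0 q≥0 = ℚ.nonNegative⁻¹ (p ℚ.* q)
  {{ℚ.nonNeg*nonNeg⇒nonNeg p {{ℚ.nonNegative p≥0}} q {{ℚ.nonNegative q≥0}}}}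

≤+ : {p q : ℚ} → 0ℚ ℚ.≤ p → q ℚ.≤ p ℚ.+ q
≤+ {p} {q} p≥0 = subst (ℚ._≤ p ℚ.+ q) (ℚ.+-identityˡ q) (ℚ.+-mono-≤ p≥0 (ℚ.≤-refl {q}))

p*q≡0⇒p≡0 : {p q : ℚ} → 0ℚ ℚ.< q → p ℚ.* q ≡ 0ℚ → p ≡ 0ℚ
p*q≡0⇒p≡0 {p} {q} q>0 eq = ℚ.≤-antisym
  (ℚ.*-cancelʳ-≤-pos q (ℚ.≤-reflexive (trans eq (sym (ℚ.*-zeroˡ q)))))
  (ℚ.*-cancelʳ-≤-pos q (ℚ.≤-reflexive (trans (ℚ.*-zeroˡ q) (sym eq))))
  where instance _ = ℚ.positive q>0

*-cancelʳ-pos : {p p' q : ℚ} → 0ℚ ℚ.< q → p ℚ.* q ≡ p' ℚ.* q → p ≡ p'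
*-cancelʳ-pos {q = q} q>0 eq = ℚ.≤-antisym
  (ℚ.*-cancelʳ-≤-pos q (ℚ.≤-reflexive eq))
  (ℚ.*-cancelʳ-≤-pos q (ℚ.≤-reflexive (sym eq)))
  where instance _ = ℚ.positive q>0

+-cancelʳ : {p p' : ℚ} (q : ℚ) → p ℚ.+ q ≡ p' ℚ.+ q → p ≡ p'
+-cancelʳ {p} {p'} q eq = trans (lem p) (trans (cong (ℚ._- q) eq) (sym (lem p')))
  where
  open +-*-Solver
  lem : ∀ r → r ≡ (r ℚ.+ q) ℚ.- q
  lem r = solve 2 (λ r q → r := (r :+ q) :- q) refl r q

p-q≡0⇒p≡q : {p q : ℚ} → p ℚ.- q ≡ 0ℚ → p ≡ q
p-q≡0⇒p≡q {p} {q} eq = +-cancelʳ (ℚ.- q) (trans eq (sym (ℚ.+-inverseʳ q)))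

p≤q⇒0≤q-p : {p q : ℚ} → p ℚ.≤ q → 0ℚ ℚ.≤ q ℚ.- p
p≤q⇒0≤q-p {p} {q} p≤q = subst (ℚ._≤ q ℚ.- p) (ℚ.+-inverseʳ p) (ℚ.+-mono-≤ p≤q ℚ.≤-refl)

argmin : (f : Fin (suc k) → ℚ) → ∃ λ j → ∀ i → f j ℚ.≤ f i
argmin {zero}  f = zero , λ { zero → ℚ.≤-refl }
argmin {suc k} f with argmin (f ∘ suc)
... | j , min with ℚ.≤-total (f zero) (f (suc j))
...   | inj₁ le = zero , λ { zero → ℚ.≤-refl ; (suc i) → ℚ.≤-trans le (min i) }
...   | inj₂ ge = suc j , λ { zero → ge ; (suc i) → min i }

0<1 : 0ℚ ℚ.< 1ℚ
0<1 = ℚ.positive⁻¹ 1ℚ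

0≤1 : 0ℚ ℚ.≤ 1ℚ
0≤1 = ℚ.nonNegative⁻¹ 1ℚ

-- `μ` is the weight 1/k that the barycentre gives to each of k points. Its inverse `M` turns an
-- amount shared by all k weights into a weight at the barycentre.
record Uniform (k : ℕ) : Set where
  field
    M μ   : ℚ
    M*μ≡1 : M ℚ.* μ ≡ 1ℚ
    M≥0   : 0ℚ ℚ.≤ M
    μ>0   : 0ℚ ℚ.< μ
    Σμ≡1  : Σℚ {k} (const μ) ≡ 1ℚ

abstract
  uniform : ∀ k → Uniform (suc k)
  uniform k = record
    { M = M ; μ = ℚ.1/ M ; M*μ≡1 = ℚ.*-inverseʳ M ; M≥0 = ℚ.<⇒≤ M>0
    ; μ>0 = ℚ.positive⁻¹ (ℚ.1/ M) {{ℚ.1/pos⇒pos M}}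
    ; Σμ≡1 = trans (Σ-cong {suc k} (λ _ → sym (ℚ.*-identityʳ (ℚ.1/ M))))
               (trans (Σ-*ˡ {suc k} (ℚ.1/ M) (const 1ℚ)) (ℚ.*-inverseˡ M)) }
    where
    M : ℚ
    M = Σℚ {suc k} (const 1ℚ)
    M>0 : 0ℚ ℚ.< M
    M>0 = ℚ.<-≤-trans 0<1 (term≤Σ {suc k} {const 1ℚ} (λ _ → 0≤1) zero)
    instance
      M-positive : ℚ.Positive M
      M-positive = ℚ.positive M>0
      M-nonZero : ℚ.NonZero M
      M-nonZero = ℚ.pos⇒nonZero M

-- Points and their combinations

NonNeg : (Fin k → ℚ) → Set
NonNeg w = ∀ i → 0ℚ ℚ.≤ w i

corner-same : (j : Fin (suc d)) → corner j j ≡ 1ℚ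
corner-same j with j ≟ j
... | yes _  = refl
... | no j≢j = contradiction refl j≢j

corner-other : {i j : Fin (suc d)} → j ≢ i → corner j i ≡ 0ℚ
corner-other {i = i} {j} j≢i with j ≟ i
... | yes j≡i = contradiction j≡i j≢i
... | no _    = refl

corner-suc : (j i : Fin (suc d)) → corner (suc j) (suc i) ≡ corner j i
corner-suc j i with j ≟ i
... | yes _ = refl
... | no _  = refl

corner-nonneg : (j : Fin (suc d)) → NonNeg (corner j)
corner-nonneg j i with j ≟ i
... | yes _ = 0≤1
... | no _  = ℚ.≤-refl

Σ-corner : (j : Fin (suc d)) → Σℚ (corner j) ≡ 1ℚ
Σ-corner j = trans (Σ-single j (corner j) λ i i≢j → corner-other (i≢j ∘ sym)) (corner-same j)

comb-cong : {w w' : Fin (suc d) → ℚ} (p : Fin (suc d) → Point d) →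
  (∀ i → w i ≡ w' i) → comb w p ≐ comb w' p
comb-cong p eq j = Σ-cong λ i → cong (ℚ._* p i j) (eq i)

comb-corner : (l : Fin (suc d)) (p : Fin (suc d) → Point d) → comb (corner l) p ≐ p l
comb-corner l p j = trans
  (Σ-single l _ λ i i≢l → trans (cong (ℚ._* p i j) (corner-other (i≢l ∘ sym))) (ℚ.*-zeroˡ (p i j)))
  (trans (cong (ℚ._* p l j) (corner-same l)) (ℚ.*-identityˡ _))

Σ-comb : (w : Fin (suc d) → ℚ) (p : Fin (suc d) → Point d) →
  (∀ i → Σℚ (p i) ≡ 1ℚ) → Σℚ (comb w p) ≡ Σℚ w
Σ-comb w p unit = trans (Σ-swap (λ j i → w i ℚ.* p i j))
  (Σ-cong {g = w} λ i →
    trans (Σ-*ˡ (w i) (p i)) (trans (cong (w i ℚ.*_) (unit i)) (ℚ.*-identityʳ (w i))))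

-- For points of coordinate sum 1 this agrees with `AffIndep`: by `Σ-comb`, a vanishing combination
-- has weights of sum 0.
LinIndep : (Fin (suc d) → Point d) → Set
LinIndep p = ∀ w → (∀ j → comb w p j ≡ 0ℚ) → ∀ i → w i ≡ 0ℚ

comb-unique : {p : Fin (suc d) → Point d} → LinIndep p →
  {w w' : Fin (suc d) → ℚ} → comb w p ≐ comb w' p → ∀ i → w i ≡ w' i
comb-unique {p = p} indep {w} {w'} eq i = p-q≡0⇒p≡q (indep (λ i → w i ℚ.- w' i) vanish i)
  where
  open ≡-Reasoning
  open +-*-Solver
  vanish : ∀ j → comb (λ i → w i ℚ.- w' i) p j ≡ 0ℚ
  vanish j = begin
    Σℚ (λ i → (w i ℚ.- w' i) ℚ.* p i j)
      ≡⟨ Σ-cong (λ i → solve 3 (λ a b c → (a :- b) :* c := a :* c :+ con (ℚ.- 1ℚ) :* (b :* c))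
                         refl (w i) (w' i) (p i j)) ⟩
    Σℚ (λ i → w i ℚ.* p i j ℚ.+ (ℚ.- 1ℚ) ℚ.* (w' i ℚ.* p i j))
      ≡⟨ Σ-+ (λ i → w i ℚ.* p i j) (λ i → (ℚ.- 1ℚ) ℚ.* (w' i ℚ.* p i j)) ⟩
    comb w p j ℚ.+ Σℚ (λ i → (ℚ.- 1ℚ) ℚ.* (w' i ℚ.* p i j))
      ≡⟨ cong₂ ℚ._+_ (eq j) (Σ-*ˡ (ℚ.- 1ℚ) (λ i → w' i ℚ.* p i j)) ⟩
    comb w' p j ℚ.+ (ℚ.- 1ℚ) ℚ.* comb w' p j
      ≡⟨ solve 1 (λ a → a :+ con (ℚ.- 1ℚ) :* a := con 0ℚ) refl (comb w' p j) ⟩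
    0ℚ ∎

-- The weight vectors `corner i` and `corner l` both represent the common point, so uniqueness of
-- weights makes them equal.
LinIndep⇒injective : {p : Fin (suc d) → Point d} → LinIndep p →
  ∀ {i l} → p i ≐ p l → i ≡ l
LinIndep⇒injective {p = p} indep {i} {l} eq with l ≟ i
... | yes l≡i = sym l≡i
... | no l≢i  = contradiction
  (trans (sym (corner-same i)) (trans (comb-unique {p = p} indep {corner i} {corner l} same i) (corner-other l≢i)))
  (λ ())
  where
  same : comb (corner i) p ≐ comb (corner l) p
  same j = trans (comb-corner i p j) (trans (eq j) (sym (comb-corner l p j)))

-- A triangulation is stored as the simplicial fan over it: since every vertex
-- has coordinate sum 1, weights of points of Δ^d automatically sum to 1.
record Fan (d n m : ℕ) : Set where
  field
    vert  : Fin n → Point d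
    facet : Fin m → Fin (suc d) → Fin n

  corners-of : Fin m → Fin (suc d) → Point d
  corners-of r l = vert (facet r l)

  field
    vert-in   : ∀ i → InDelta d (vert i)
    vert-inj  : ∀ i i' → vert i ≐ vert i' → i ≡ i'
    vert-used : ∀ i → ∃ λ r → ∃ λ l → facet r l ≡ i
    corners   : ∀ j → ∃ λ i → vert i ≐ corner j
    indep     : ∀ r → LinIndep (corners-of r)
    distinct  : ∀ r s → (∀ k → ∃ λ l → facet r k ≡ facet s l) → r ≡ s
    meet      : ∀ r s {w w'} → NonNeg w → NonNeg w' →
      comb w (corners-of r) ≐ comb w' (corners-of s) →
      ∀ k → w k ≡ 0ℚ ⊎ ∃ λ l → facet r k ≡ facet s l × w k ≡ w' l
    cover     : ∀ x → NonNeg x → ∃ λ r → ∃ λ w → NonNeg w × comb w (corners-of r) ≐ x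

  facet-inj : ∀ r {k l} → facet r k ≡ facet r l → k ≡ l
  facet-inj r eq = LinIndep⇒injective (indep r) λ j → cong (λ i → vert i j) eq

open Fan

triangulation : Fan d n m → Triangulation d
triangulation {d} {n} {m} K = record
  { n = n ; m = m ; vert = vert K ; facet = facet K
  ; vert-in = vert-in K ; vert-inj = vert-inj K ; vert-used = vert-used K ; corners = corners K
  ; facet-indep = λ r w _ → indep K r w
  ; facet-distinct = distinct K
  ; facet-meet = facet-meet
  ; cover = cov
  }
  where
  facet-meet : ∀ r s x → InConv (corners-of K r) x → InConv (corners-of K s) x →
    ∃ λ w → Convex w × (comb w (corners-of K r) ≐ x) ×
      (∀ k → w k ≢ 0ℚ → ∃ λ l → facet K r k ≡ facet K s l)
  facet-meet r s x (w , cw , eq) (w' , cw' , eq') = w , cw , eq , common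
    where
    common : ∀ k → w k ≢ 0ℚ → ∃ λ l → facet K r k ≡ facet K s l
    common k wk≢0 with meet K r s (proj₁ cw) (proj₁ cw') (λ j → trans (eq j) (sym (eq' j))) k
    ... | inj₁ wk≡0          = contradiction wk≡0 wk≢0
    ... | inj₂ (l , kl , _) = l , kl
  cov : ∀ x → InDelta d x → ∃ λ r → InConv (corners-of K r) x
  cov x (x≥0 , Σx) with cover K x x≥0
  ... | r , w , w≥0 , eq = r , w , (w≥0 , Σw) , eq
    where
    Σw = trans (sym (Σ-comb w (corners-of K r) (λ i → proj₂ (vert-in K _))))
               (trans (Σ-cong eq) Σx)

-- Colourings

Sperner : Fan d n m → (Fin n → Fin (suc d)) → Set
Sperner K c = ∀ i j → vert K i j ≡ 0ℚ → c i ≢ j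

Rainbow : (Fin (suc d) → Fin n) → (Fin n → Fin (suc d)) → Set
Rainbow f c = ∀ k l → c (f k) ≡ c (f l) → k ≡ l

NeverAlone : Fan d n m → Fin m → Set
NeverAlone K r = ∀ c → Sperner K c → ∃ λ s → s ≢ r × Rainbow (facet K s) c

injective⇒surjective : (f : Fin k → Fin k) → (∀ i j → f i ≡ f j → i ≡ j) → ∀ y → ∃ λ i → f i ≡ y
injective⇒surjective {suc k} f inj y with Fin.any? (λ i → f i ≟ y)
... | yes hit = hit
... | no miss = contradiction (Fin.injective⇒≤ {f = g} λ {i} {j} eq → inj i j (Fin.punchOut-injective {i = y} _ _ eq)) ℕ.1+n≰n
  where
  g : Fin (suc k) → Fin k
  g i = punchOut {i = y} {j = f i} (λ eq → miss (i , sym eq))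

-- The vertices `w_τ` form a clique, so each of the d+1 colours occurs on exactly one of them.
-- Renaming colours by the inverse of `π` gives `w_j` the colour `j`, and the edges `u_i w_j` become
-- the Sperner condition. For `s` other than `r`, every edge at `v_s` is still present, so the
-- colour of `v_s` is missing on facet `s`; a rainbow facet misses no colour.
NeverAlone⇒¬Critical : (K : Fan d n m) (r : Fin m) → NeverAlone K r →
  ¬ Critical G[ triangulation K ] (d + 2)
NeverAlone⇒¬Critical {d} {n} {m} K r never (_ , crit) = absurd
  (subst (Colourable H) (cong (_∸ 1) (ℕ.+-comm d 2))
    (crit (inj₁ (facet K r zero)) (inj₂ (inj₁ r)) (zero , refl)))
  where
  H : Graph
  H = deleteEdge G[ triangulation K ] (inj₁ (facet K r zero)) (inj₂ (inj₁ r))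

  absurd : ¬ Colourable H (suc d)
  absurd (col , proper) = no-rainbow (never c sperner)
    where
    π : Fin (suc d) → Fin (suc d)
    π j = col (inj₂ (inj₂ j))

    π-inj : ∀ i j → π i ≡ π j → i ≡ j
    π-inj i j eq = decidable-stable (i ≟ j)
      λ i≢j → proper (inj₂ (inj₂ i)) (inj₂ (inj₂ j))
        (i≢j , λ { (inj₁ (_ , ())) ; (inj₂ (() , _)) }) eq

    c : Fin n → Fin (suc d)
    c i = proj₁ (injective⇒surjective π π-inj (col (inj₁ i)))

    π∘c : ∀ i → π (c i) ≡ col (inj₁ i)
    π∘c i = proj₂ (injective⇒surjective π π-inj (col (inj₁ i)))

    sperner : Sperner K c
    sperner i j on-face refl = proper (inj₁ i) (inj₂ (inj₂ (c i)))
      (on-face , λ { (inj₁ (_ , ())) ; (inj₂ (() , _)) }) (sym (π∘c i))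

    no-rainbow : ¬ ∃ λ s → s ≢ r × Rainbow (facet K s) c
    no-rainbow (s , s≢r , rainbow)
      with injective⇒surjective π π-inj (col (inj₂ (inj₁ s)))
    ... | y , πy with injective⇒surjective (c ∘ facet K s) rainbow y
    ...   | k , refl = proper (inj₁ (facet K s k)) (inj₂ (inj₁ s))
      ((k , refl) , λ { (inj₁ (_ , refl)) → s≢r refl ; (inj₂ (() , _)) })
      (trans (sym (π∘c (facet K s k))) πy)

-- Coning and stacking

module _ (K : Fan d n (suc m)) where

  -- The base lies in the face where the first coordinate vanishes and the apex is the opposite
  -- corner. The first coordinate of a point is therefore its apex weight, and the others form a
  -- point over the base.
  coneVert : Fin (suc n) → Point (suc d)
  coneVert zero    = corner zero
  coneVert (suc i) zero    = 0ℚ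
  coneVert (suc i) (suc j) = vert K i j

  coneFacet : Fin (suc m) → Fin (suc (suc d)) → Fin (suc n)
  coneFacet r zero    = zero
  coneFacet r (suc l) = suc (facet K r l)

  private
    p : Fin (suc m) → Fin (suc (suc d)) → Point (suc d)
    p r l = coneVert (coneFacet r l)

  comb-cone-zero : ∀ r w → comb w (p r) zero ≡ w zero
  comb-cone-zero r w = trans (Σ-single zero (λ l → w l ℚ.* p r l zero) vanish)
                             (ℚ.*-identityʳ (w zero))
    where
    vanish : ∀ i → i ≢ zero → w i ℚ.* p r i zero ≡ 0ℚ
    vanish zero    0≢0 = contradiction refl 0≢0
    vanish (suc i) _   = ℚ.*-zeroʳ (w (suc i))

  comb-cone-suc : ∀ r w j → comb w (p r) (suc j) ≡ comb (w ∘ suc) (corners-of K r) j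
  comb-cone-suc r w j = trans (cong (ℚ._+ comb (w ∘ suc) (corners-of K r) j) (ℚ.*-zeroʳ (w zero)))
                              (ℚ.+-identityˡ _)

  cone : Fan (suc d) (suc n) (suc m)
  cone .vert  = coneVert
  cone .facet = coneFacet
  cone .vert-in zero    = corner-nonneg zero , Σ-corner {suc d} zero
  cone .vert-in (suc i) = (λ { zero → ℚ.≤-refl ; (suc j) → proj₁ (vert-in K i) j }) ,
    trans (ℚ.+-identityˡ _) (proj₂ (vert-in K i))
  cone .vert-inj zero    zero     eq = refl
  cone .vert-inj zero    (suc i') eq = contradiction (eq zero) λ ()
  cone .vert-inj (suc i) zero     eq = contradiction (eq zero) λ ()
  cone .vert-inj (suc i) (suc i') eq = cong suc (vert-inj K i i' (eq ∘ suc))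
  cone .vert-used zero    = zero , zero , refl
  cone .vert-used (suc i) with vert-used K i
  ... | r , l , refl = r , suc l , refl
  cone .corners zero    = zero , λ _ → refl
  cone .corners (suc j) with corners K j
  ... | i , eq = suc i , λ { zero → refl ; (suc l) → trans (eq l) (sym (corner-suc j l)) }
  cone .indep r w vanish zero    = trans (sym (comb-cone-zero r w)) (vanish zero)
  cone .indep r w vanish (suc l) = indep K r (w ∘ suc)
    (λ j → trans (sym (comb-cone-suc r w j)) (vanish (suc j))) l
  cone .distinct r s sub = distinct K r s λ l → base l (sub (suc l))
    where
    base : ∀ l → (∃ λ l' → suc (facet K r l) ≡ coneFacet s l') →
      ∃ λ l' → facet K r l ≡ facet K s l'
    base l (suc l' , eq) = l' , Fin.suc-injective eq
  cone .meet r s {w} {w'} w≥0 w'≥0 eq = common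
    where
    common : ∀ k → w k ≡ 0ℚ ⊎ ∃ λ l → coneFacet r k ≡ coneFacet s l × w k ≡ w' l
    common zero = inj₂ (zero , refl ,
      trans (sym (comb-cone-zero r w)) (trans (eq zero) (comb-cone-zero s w')))
    common (suc k) with meet K r s (w≥0 ∘ suc) (w'≥0 ∘ suc)
      (λ j → trans (sym (comb-cone-suc r w j)) (trans (eq (suc j)) (comb-cone-suc s w' j))) k
    ... | inj₁ wk≡0          = inj₁ wk≡0
    ... | inj₂ (l , kl , wl) = inj₂ (suc l , cong suc kl , wl)
  cone .cover x x≥0 with cover K (x ∘ suc) (x≥0 ∘ suc)
  ... | r , w , w≥0 , eq = r , w⁺ , (λ { zero → x≥0 zero ; (suc l) → w≥0 l }) ,
    λ { zero → comb-cone-zero r w⁺ ; (suc j) → trans (comb-cone-suc r w⁺ j) (eq j) }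
    where
    w⁺ : Fin (suc (suc d)) → ℚ
    w⁺ zero    = x zero
    w⁺ (suc l) = w l

  -- The apex lies on every facet of Δ^{d+1} but one, so its colour is forced, and
  -- that colour is forbidden on the base.
  cone-NeverAlone : ∀ r → NeverAlone K r → NeverAlone cone r
  cone-NeverAlone r never c sperner = extend (never c' sperner')
    where
    base≢0 : ∀ i → zero ≢ c (suc i)
    base≢0 i eq = sperner (suc i) zero refl (sym eq)

    c' : Fin n → Fin (suc d)
    c' i = punchOut (base≢0 i)

    sperner' : Sperner K c'
    sperner' i j on-face eq = sperner (suc i) (suc j) on-face
      (trans (sym (Fin.punchIn-punchOut (base≢0 i))) (cong suc eq))

    apex : c zero ≡ zero
    apex with c zero in eq
    ... | zero  = refl
    ... | suc j = contradiction eq (sperner zero (suc j) refl)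

    extend : (∃ λ s → s ≢ r × Rainbow (facet K s) c') →
      ∃ λ s → s ≢ r × Rainbow (coneFacet s) c
    extend (s , s≢r , rainbow) = s , s≢r , rainbow⁺
      where
      rainbow⁺ : Rainbow (coneFacet s) c
      rainbow⁺ zero    zero    eq = refl
      rainbow⁺ zero    (suc l) eq = contradiction (trans (sym apex) eq) (base≢0 _)
      rainbow⁺ (suc k) zero    eq = contradiction (trans (sym apex) (sym eq)) (base≢0 _)
      rainbow⁺ (suc k) (suc l) eq =
        cong suc (rainbow k l (Fin.punchOut-cong zero {i≢j = base≢0 _} {i≢k = base≢0 _} eq))

other : (k : Fin (suc (suc d))) → ∃ λ j → k ≢ j
other zero    = suc zero , λ ()
other (suc k) = zero , λ ()

-- Facet zero is subdivided at its barycentre; the new facets come first.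

module _ (K : Fan (suc d) n (suc m)) where

  private
    D : ℕ
    D = suc (suc d)

    a : Fin D → Point (suc d)
    a = corners-of K zero

    open Uniform (uniform (suc d))

    μ≥0 : 0ℚ ℚ.≤ μ
    μ≥0 = ℚ.<⇒≤ μ>0

  barycentre : Point (suc d)
  barycentre = comb (const μ) a

  stackVert : Fin (suc n) → Point (suc d)
  stackVert zero    = barycentre
  stackVert (suc i) = vert K i

  newFacet : Fin D → Fin D → Fin (suc n)
  newFacet j l with l ≟ j
  ... | yes _ = zero
  ... | no  _ = suc (facet K zero l)

  newFacet-same : ∀ j → newFacet j j ≡ zero
  newFacet-same j with j ≟ j
  ... | yes _  = refl
  ... | no j≢j = contradiction refl j≢j

  newFacet-other : ∀ {j l} → l ≢ j → newFacet j l ≡ suc (facet K zero l)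
  newFacet-other {j} {l} l≢j with l ≟ j
  ... | yes l≡j = contradiction l≡j l≢j
  ... | no _    = refl

  stackFacet : Fin D ⊎ Fin m → Fin D → Fin (suc n)
  stackFacet (inj₁ j) l = newFacet j l
  stackFacet (inj₂ r) l = suc (facet K (suc r) l)

  private
    p : Fin D ⊎ Fin m → Fin D → Point (suc d)
    p r l = stackVert (stackFacet r l)

    -- weights on facet zero of the point with weights w on the j-th new facet
    pull : Fin D → (Fin D → ℚ) → Fin D → ℚ
    pull j w l = dropAt j w l ℚ.+ w j ℚ.* μ

    pull-same : ∀ j w → pull j w j ≡ w j ℚ.* μ
    pull-same j w = trans (cong (ℚ._+ w j ℚ.* μ) (dropAt-same j w)) (ℚ.+-identityˡ _)

    pull-other : ∀ {j l} w → l ≢ j → pull j w l ≡ w l ℚ.+ w j ℚ.* μ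
    pull-other {j} w l≢j = cong (ℚ._+ w j ℚ.* μ) (dropAt-other w l≢j)

    -- With `pull-same` this makes the share `w j * μ` coming from the barycentre the minimum of the
    -- pulled weights, attained at `j`. The share can thus be recovered from the point alone,
    -- whichever new facet it was written in.
    pull≥ : ∀ j {w} → NonNeg w → ∀ l → w j ℚ.* μ ℚ.≤ pull j w l
    pull≥ j {w} w≥0 l with l ≟ j
    ... | yes _ = ≤+ ℚ.≤-refl
    ... | no  _ = ≤+ (w≥0 l)

    pull-nonneg : ∀ j {w} → NonNeg w → NonNeg (pull j w)
    pull-nonneg j w≥0 l = ℚ.≤-trans (*-nonneg (w≥0 j) μ≥0) (pull≥ j w≥0 l)

    comb-pull : ∀ j w → comb w (p (inj₁ j)) ≐ comb (pull j w) a
    comb-pull j w i = begin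
      Σℚ (λ l → w l ℚ.* p (inj₁ j) l i)
        ≡⟨ Σ-extract j (λ l → w l ℚ.* p (inj₁ j) l i) ⟩
      w j ℚ.* p (inj₁ j) j i ℚ.+ Σℚ (dropAt j (λ l → w l ℚ.* p (inj₁ j) l i))
        ≡⟨ cong₂ ℚ._+_ apex (Σ-cong rest) ⟩
      Σℚ (λ l → (w j ℚ.* μ) ℚ.* a l i) ℚ.+ Σℚ (λ l → dropAt j w l ℚ.* a l i)
        ≡⟨ Σ-+ (λ l → (w j ℚ.* μ) ℚ.* a l i) (λ l → dropAt j w l ℚ.* a l i) ⟨
      Σℚ (λ l → (w j ℚ.* μ) ℚ.* a l i ℚ.+ dropAt j w l ℚ.* a l i)
        ≡⟨ Σ-cong (λ l → solve 3 (λ t u b → t :* b :+ u :* b := (u :+ t) :* b) refl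
                           (w j ℚ.* μ) (dropAt j w l) (a l i)) ⟩
      comb (pull j w) a i ∎
      where
      open ≡-Reasoning
      open +-*-Solver
      apex : w j ℚ.* p (inj₁ j) j i ≡ Σℚ (λ l → (w j ℚ.* μ) ℚ.* a l i)
      apex = trans (cong (λ v → w j ℚ.* stackVert v i) (newFacet-same j))
        (trans (sym (Σ-*ˡ (w j) (λ l → μ ℚ.* a l i)))
          (Σ-cong (λ l → sym (ℚ.*-assoc (w j) μ (a l i)))))
      rest : ∀ l → dropAt j (λ l → w l ℚ.* p (inj₁ j) l i) l ≡ dropAt j w l ℚ.* a l i
      rest l with l ≟ j
      ... | yes _  = sym (ℚ.*-zeroˡ (a l i))
      ... | no l≢j = cong (λ v → w l ℚ.* stackVert v i) (newFacet-other l≢j)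

    -- If the barycentre were the vertex `k` of a facet `r`, then `meet` would match each vertex of
    -- facet zero, having weight `μ` > 0, with a vertex of `r` of nonzero weight. That can only be
    -- `k`, so all vertices of facet zero would coincide.
    barycentre-new : ∀ i → ¬ barycentre ≐ vert K i
    barycentre-new i eq with vert-used K i
    ... | r , k , refl = contradiction
      (facet-inj K zero (trans (is-k zero) (sym (is-k (suc zero))))) λ ()
      where
      is-k : ∀ l → facet K zero l ≡ facet K r k
      is-k l with meet K zero r {const μ} {corner k} (λ _ → μ≥0) (corner-nonneg k)
        (λ j → trans (eq j) (sym (comb-corner k (corners-of K r) j))) l
      ... | inj₁ μ≡0 = contradiction (sym μ≡0) (ℚ.<⇒≢ μ>0)
      ... | inj₂ (l' , same , μ≡) with k ≟ l'
      ...   | yes refl = same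
      ...   | no k≢l'  = contradiction (sym μ≡) (ℚ.<⇒≢ μ>0)

    -- Among the new facets only `newFacet j'` lacks the vertex of facet zero at `j'`. A new facet
    -- is not inside an old one because of the barycentre, and an old facet inside a new one would
    -- lie inside facet zero.
    stack-distinct : ∀ r s → (∀ k → ∃ λ l → stackFacet r k ≡ stackFacet s l) → r ≡ s
    stack-distinct (inj₁ j) (inj₁ j') sub with j' ≟ j
    ... | yes refl = refl
    ... | no j'≢j with sub j'
    ...   | l , eq with l ≟ j'
    ...     | yes _   = contradiction (trans (sym (newFacet-other j'≢j)) eq) λ ()
    ...     | no l≢j' = contradiction
      (sym (facet-inj K zero (Fin.suc-injective (trans (sym (newFacet-other j'≢j)) eq)))) l≢j'
    stack-distinct (inj₁ j) (inj₂ s) sub with sub j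
    ... | l , eq = contradiction (trans (sym (newFacet-same j)) eq) λ ()
    stack-distinct (inj₂ r) (inj₁ j) sub = contradiction (distinct K (suc r) zero old) λ ()
      where
      old : ∀ k → ∃ λ l → facet K (suc r) k ≡ facet K zero l
      old k with sub k
      ... | l , eq with l ≟ j
      ...   | yes _ = contradiction eq λ ()
      ...   | no _  = l , Fin.suc-injective eq
    stack-distinct (inj₂ r) (inj₂ s) sub = cong inj₂ (Fin.suc-injective
      (distinct K (suc r) (suc s) λ k → proj₁ (sub k) , Fin.suc-injective (proj₂ (sub k))))

    Common : (r s : Fin D ⊎ Fin m) (w w' : Fin D → ℚ) → Set
    Common r s w w' =
      ∀ k → w k ≡ 0ℚ ⊎ ∃ λ l → stackFacet r k ≡ stackFacet s l × w k ≡ w' l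

    pull-apex-≤ : ∀ j j' {w w'} → NonNeg w' → (∀ l → pull j w l ≡ pull j' w' l) →
      w' j' ℚ.* μ ℚ.≤ w j ℚ.* μ
    pull-apex-≤ j j' {w} {w'} w'≥0 eq =
      subst (w' j' ℚ.* μ ℚ.≤_) (trans (sym (eq j)) (pull-same j w)) (pull≥ j' w'≥0 j)

    -- Both weight vectors pull back to the same weights on facet zero. The barycentre shares are
    -- both the minimum of these, hence equal, and subtracting them matches the remaining weights.
    -- At `k = j'` nothing remains, so `w k` is zero there.
    meet-new-new : ∀ j j' {w w'} → NonNeg w → NonNeg w' →
      comb w (p (inj₁ j)) ≐ comb w' (p (inj₁ j')) → Common (inj₁ j) (inj₁ j') w w'
    meet-new-new j j' {w} {w'} w≥0 w'≥0 eq = common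
      where
      same : ∀ l → pull j w l ≡ pull j' w' l
      same = comb-unique {p = a} (indep K zero) {pull j w} {pull j' w'}
        λ i → trans (sym (comb-pull j w i)) (trans (eq i) (comb-pull j' w' i))
      apex : w j ℚ.* μ ≡ w' j' ℚ.* μ
      apex = ℚ.≤-antisym (pull-apex-≤ j' j {w'} {w} w≥0 (sym ∘ same))
                         (pull-apex-≤ j j' {w} {w'} w'≥0 same)
      common : Common (inj₁ j) (inj₁ j') w w'
      common k with k ≟ j
      ... | yes refl = inj₂ (j' , sym (newFacet-same j') , *-cancelʳ-pos μ>0 apex)
      ... | no k≢j with k ≟ j'
      ...   | yes refl = inj₁ (+-cancelʳ (w j ℚ.* μ) (trans (sym (pull-other w k≢j))
                (trans (same k) (trans (pull-same k w')
                  (trans (sym apex) (sym (ℚ.+-identityˡ _)))))))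
      ...   | no k≢j' = inj₂ (k , sym (newFacet-other k≢j') ,
                +-cancelʳ (w j ℚ.* μ) (trans (sym (pull-other w k≢j))
                  (trans (same k) (trans (pull-other w' k≢j')
                    (cong (w' k ℚ.+_) (sym apex))))))

    meet-pull : ∀ j s {w w'} → NonNeg w → NonNeg w' →
      comb w (p (inj₁ j)) ≐ comb w' (corners-of K (suc s)) →
      ∀ k → pull j w k ≡ 0ℚ ⊎ ∃ λ l → facet K zero k ≡ facet K (suc s) l × pull j w k ≡ w' l
    meet-pull j s {w} {w'} w≥0 w'≥0 eq = meet K zero (suc s) {pull j w} {w'}
      (pull-nonneg j w≥0) w'≥0 (λ i → trans (sym (comb-pull j w i)) (eq i))

    -- A point of an old facet has weight 0 at the barycentre: otherwise all vertices
    -- of facet zero would belong to that old facet.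
    apex≡0 : ∀ j s {w w'} → NonNeg w → NonNeg w' →
      comb w (p (inj₁ j)) ≐ comb w' (corners-of K (suc s)) → w j ≡ 0ℚ
    apex≡0 j s {w} {w'} w≥0 w'≥0 eq with w j ℚ.≟ 0ℚ
    ... | yes wj≡0 = wj≡0
    ... | no wj≢0  = contradiction (distinct K zero (suc s) sub) λ ()
      where
      sub : ∀ k → ∃ λ l → facet K zero k ≡ facet K (suc s) l
      sub k = [ (λ pull≡0 → contradiction (p*q≡0⇒p≡0 μ>0 (ℚ.≤-antisym
                  (ℚ.≤-trans (pull≥ j w≥0 k) (ℚ.≤-reflexive pull≡0))
                  (*-nonneg (w≥0 j) μ≥0))) wj≢0)
              , (λ { (l , kl , _) → l , kl }) ]′
        (meet-pull j s w≥0 w'≥0 eq k)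

    pull-apex≡0 : ∀ j {w} → w j ≡ 0ℚ → ∀ l → pull j w l ≡ w l
    pull-apex≡0 j {w} wj≡0 l with l ≟ j
    ... | yes refl = trans (ℚ.+-identityˡ _)
            (trans (cong (ℚ._* μ) wj≡0) (trans (ℚ.*-zeroˡ μ) (sym wj≡0)))
    ... | no _     = trans (cong (w l ℚ.+_) (trans (cong (ℚ._* μ) wj≡0) (ℚ.*-zeroˡ μ)))
            (ℚ.+-identityʳ _)

    meet-new-old : ∀ j s {w w'} → NonNeg w → NonNeg w' →
      comb w (p (inj₁ j)) ≐ comb w' (p (inj₂ s)) → Common (inj₁ j) (inj₂ s) w w'
    meet-new-old j s {w} {w'} w≥0 w'≥0 eq k with k ≟ j
    ... | yes refl = inj₁ (apex≡0 j s w≥0 w'≥0 eq)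
    ... | no _     = [ (λ pull≡0 → inj₁ (trans (sym same) pull≡0))
                     , (λ { (l , kl , wl) → inj₂ (l , cong suc kl , trans (sym same) wl) }) ]′
                     (meet-pull j s w≥0 w'≥0 eq k)
      where
      same : pull j w k ≡ w k
      same = pull-apex≡0 j (apex≡0 j s w≥0 w'≥0 eq) k

    meet-old-new : ∀ s j {w w'} → NonNeg w → NonNeg w' →
      comb w (p (inj₂ s)) ≐ comb w' (p (inj₁ j)) → Common (inj₂ s) (inj₁ j) w w'
    meet-old-new s j {w} {w'} w≥0 w'≥0 eq k =
      [ inj₁ , (λ { (l , kl , wl) → at l kl (trans wl (pull-apex≡0 j wj≡0 l)) (l ≟ j) }) ]′
      (meet K (suc s) zero {w} {pull j w'} w≥0 (pull-nonneg j w'≥0)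
        (λ i → trans (eq i) (comb-pull j w' i)) k)
      where
      wj≡0 : w' j ≡ 0ℚ
      wj≡0 = apex≡0 j s w'≥0 w≥0 (sym ∘ eq)
      at : ∀ l → facet K (suc s) k ≡ facet K zero l → w k ≡ w' l → Dec (l ≡ j) →
        w k ≡ 0ℚ ⊎ ∃ λ l → suc (facet K (suc s) k) ≡ newFacet j l × w k ≡ w' l
      -- The vertex of facet zero at `j` is absent from the new facet, but its pulled weight equals
      -- the weight of the barycentre, which is zero.
      at l kl wk≡ (yes refl) = inj₁ (trans wk≡ wj≡0)
      at l kl wk≡ (no l≢j)   =
        inj₂ (l , trans (cong suc kl) (sym (newFacet-other l≢j)) , wk≡)

    meet-old-old : ∀ r s {w w'} → NonNeg w → NonNeg w' →
      comb w (p (inj₂ r)) ≐ comb w' (p (inj₂ s)) → Common (inj₂ r) (inj₂ s) w w'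
    meet-old-old r s w≥0 w'≥0 eq k with meet K (suc r) (suc s) w≥0 w'≥0 eq k
    ... | inj₁ wk≡0          = inj₁ wk≡0
    ... | inj₂ (l , kl , wl) = inj₂ (l , cong suc kl , wl)

    stack-meet : ∀ r s {w w'} → NonNeg w → NonNeg w' → comb w (p r) ≐ comb w' (p s) →
      Common r s w w'
    stack-meet (inj₁ j) (inj₁ j') = meet-new-new j j'
    stack-meet (inj₁ j) (inj₂ s)  = meet-new-old j s
    stack-meet (inj₂ r) (inj₁ j)  = meet-old-new r j
    stack-meet (inj₂ r) (inj₂ s)  = meet-old-old r s

    stack-indep : ∀ r → LinIndep (p r)
    stack-indep (inj₂ r) = indep K (suc r)
    stack-indep (inj₁ j) w vanish l =
      trans (sym (pull-apex≡0 j wj≡0 l)) (pull≡0 l)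
      where
      pull≡0 : ∀ l → pull j w l ≡ 0ℚ
      pull≡0 = indep K zero (pull j w) λ i → trans (sym (comb-pull j w i)) (vanish i)
      wj≡0 : w j ≡ 0ℚ
      wj≡0 = p*q≡0⇒p≡0 μ>0 (trans (sym (pull-same j w)) (pull≡0 j))

    -- The new facet to use replaces a vertex of least weight. Subtracting that least weight
    -- everywhere leaves nonnegative weights, and the constant part removed is `w j * M` times the
    -- barycentre.
    stack-cover : ∀ x → NonNeg x → ∃ λ r → ∃ λ w → NonNeg w × comb w (p r) ≐ x
    stack-cover x x≥0 with cover K x x≥0
    ... | suc r , w , w≥0 , eq = inj₂ r , w , w≥0 , eq
    ... | zero  , w , w≥0 , eq with argmin w
    ...   | j , least = inj₁ j , v , v≥0 ,
              λ i → trans (comb-pull j v i) (trans (comb-cong a pulled i) (eq i))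
      where
      v : Fin D → ℚ
      v l with l ≟ j
      ... | yes _ = w j ℚ.* M
      ... | no  _ = w l ℚ.- w j
      v-same : v j ≡ w j ℚ.* M
      v-same with j ≟ j
      ... | yes _  = refl
      ... | no j≢j = contradiction refl j≢j
      v≥0 : NonNeg v
      v≥0 l with l ≟ j
      ... | yes _ = *-nonneg (w≥0 j) M≥0
      ... | no  _ = p≤q⇒0≤q-p (least l)
      apex : v j ℚ.* μ ≡ w j
      apex = trans (cong (ℚ._* μ) v-same) (trans (ℚ.*-assoc (w j) M μ)
        (trans (cong (w j ℚ.*_) (M*μ≡1)) (ℚ.*-identityʳ (w j))))
      pulled : ∀ l → pull j v l ≡ w l
      pulled l with l ≟ j
      ... | yes refl = trans (ℚ.+-identityˡ _) apex
      ... | no l≢j   = trans (cong₂ ℚ._+_ (v-other l≢j) apex)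
              (solve 2 (λ x y → (x :- y) :+ y := x) refl (w l) (w j))
        where
        open +-*-Solver
        v-other : ∀ {l} → l ≢ j → v l ≡ w l ℚ.- w j
        v-other {l} l≢j with l ≟ j
        ... | yes l≡j = contradiction l≡j l≢j
        ... | no _    = refl

  stack : Fan (suc d) (suc n) (D + m)
  stack .vert = stackVert
  stack .facet r = stackFacet (splitAt D r)
  stack .vert-in (suc i) = vert-in K i
  stack .vert-in zero    =
    (λ j → Σ-nonneg {f = λ l → μ ℚ.* a l j} λ l → *-nonneg μ≥0 (proj₁ (vert-in K _) j)) ,
    trans (Σ-comb (const μ) a (λ l → proj₂ (vert-in K _))) Σμ≡1
  stack .vert-inj zero    zero     eq = refl
  stack .vert-inj zero    (suc i') eq = contradiction eq (barycentre-new i')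
  stack .vert-inj (suc i) zero     eq = contradiction (sym ∘ eq) (barycentre-new i)
  stack .vert-inj (suc i) (suc i') eq = cong suc (vert-inj K i i' eq)
  stack .vert-used i = used i (source i)
    where
    source : ∀ i → ∃ λ r → ∃ λ l → stackFacet r l ≡ i
    source zero = inj₁ zero , zero , refl
    source (suc i) with vert-used K i
    ... | suc r , l , refl = inj₂ r , l , refl
    -- The vertex at `l` survives in every new facet except the one that replaces it, so any index
    -- other than `l` will do.
    ... | zero  , l , refl with other l
    ...   | j , l≢j = inj₁ j , l , newFacet-other l≢j
    used : ∀ i → (∃ λ r → ∃ λ l → stackFacet r l ≡ i) →
      ∃ λ r → ∃ λ l → stackFacet (splitAt D r) l ≡ i
    used i (r , l , eq) = join D m r , l ,
      trans (cong (λ r → stackFacet r l) (Fin.splitAt-join D m r)) eq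
  stack .corners j with corners K j
  ... | i , eq = suc i , eq
  stack .indep r = stack-indep (splitAt D r)
  stack .distinct r s sub = trans (sym (Fin.join-splitAt D m r))
    (trans (cong (join D m) (stack-distinct (splitAt D r) (splitAt D s) sub))
           (Fin.join-splitAt D m s))
  stack .meet r s = stack-meet (splitAt D r) (splitAt D s)
  stack .cover x x≥0 with stack-cover x x≥0
  ... | r , w , w≥0 , eq = join D m r , w , w≥0 , λ i →
    trans (cong (λ r → comb w (p r) i) (Fin.splitAt-join D m r)) (eq i)

  -- If facet zero is rainbow, then so is the new facet in which the barycentre
  -- replaces the vertex of its own colour.
  stack-NeverAlone : ∀ r → NeverAlone K (suc r) → NeverAlone stack (join D m (inj₂ r))
  stack-NeverAlone r never c sperner with never (c ∘ suc) (λ i → sperner (suc i))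
  ... | suc s , s≢r , rainbow = join D m (inj₂ s) ,
    (λ eq → s≢r (cong suc (Fin.↑ʳ-injective D s r eq))) ,
    subst (λ q → Rainbow (stackFacet q) c) (sym (Fin.splitAt-join D m (inj₂ s))) rainbow
  ... | zero , _ , rainbow
    with injective⇒surjective (λ l → c (suc (facet K zero l))) rainbow (c zero)
  ...   | j , cj = join D m (inj₁ j) , new≢old ,
    subst (λ q → Rainbow (stackFacet q) c) (sym (Fin.splitAt-join D m (inj₁ j))) rainbow'
    where
    new≢old : join D m (inj₁ j) ≢ join D m (inj₂ r)
    new≢old eq with trans (sym (Fin.splitAt-join D m (inj₁ j)))
                      (trans (cong (splitAt D) eq) (Fin.splitAt-join D m (inj₂ r)))
    ... | ()
    recolour : ∀ l → c (newFacet j l) ≡ c (suc (facet K zero l))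
    recolour l with l ≟ j
    ... | yes refl = sym cj
    ... | no _     = refl
    rainbow' : Rainbow (newFacet j) c
    rainbow' k l eq = rainbow k l (trans (sym (recolour k)) (trans eq (recolour l)))

-- Integer functionals on rational points

Σℤ : (Fin k → ℤ) → ℤ
Σℤ {zero}  f = 0ℤ
Σℤ {suc _} f = f zero ℤ.+ Σℤ (f ∘ suc)

abstract
  -- The finite checks are made over the integers and carried to the rationals along this embedding,
  -- through its ring and order laws only.
  ι : ℤ → ℚ
  ι z = z ℚ./ 1

  private
    toι : ∀ z → ℚ.toℚᵘ (ι z) ℚᵘ.≃ ℚᵘ.mkℚᵘ z 0
    toι z = ℚ.toℚᵘ-fromℚᵘ (ℚᵘ.mkℚᵘ z 0)

  ι-0 : ι 0ℤ ≡ 0ℚ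
  ι-0 = refl

  ι-+ : ∀ y z → ι (y ℤ.+ z) ≡ ι y ℚ.+ ι z
  ι-+ y z = ℚ.toℚᵘ-injective (ℚᵘ.≃-trans (toι (y ℤ.+ z))
    (ℚᵘ.≃-trans (ℚᵘ.*≡* (cong (ℤ._* 1ℤ) (sym (cong₂ ℤ._+_ (ℤ.*-identityʳ y) (ℤ.*-identityʳ z)))))
    (ℚᵘ.≃-sym (ℚᵘ.≃-trans (ℚ.toℚᵘ-homo-+ (ι y) (ι z)) (ℚᵘ.+-cong (toι y) (toι z))))))

  ι-* : ∀ y z → ι (y ℤ.* z) ≡ ι y ℚ.* ι z
  ι-* y z = ℚ.toℚᵘ-injective (ℚᵘ.≃-trans (toι (y ℤ.* z))
    (ℚᵘ.≃-sym (ℚᵘ.≃-trans (ℚ.toℚᵘ-homo-* (ι y) (ι z)) (ℚᵘ.*-cong (toι y) (toι z)))))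

  ι-mono-≤ : ∀ {y z} → y ℤ.≤ z → ι y ℚ.≤ ι z
  ι-mono-≤ {y} {z} y≤z = ℚ.toℚᵘ-cancel-≤ (ℚᵘ.≤-respˡ-≃ (ℚᵘ.≃-sym (toι y))
    (ℚᵘ.≤-respʳ-≃ (ℚᵘ.≃-sym (toι z)) (ℚᵘ.*≤* (ℤ.*-monoʳ-≤-nonNeg 1ℤ y≤z))))

  ι-mono-< : ∀ {y z} → y ℤ.< z → ι y ℚ.< ι z
  ι-mono-< {y} {z} y<z = ℚ.toℚᵘ-cancel-< (ℚᵘ.<-respˡ-≃ (ℚᵘ.≃-sym (toι y))
    (ℚᵘ.<-respʳ-≃ (ℚᵘ.≃-sym (toι z)) (ℚᵘ.*<* (ℤ.*-monoʳ-<-pos 1ℤ y<z))))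

  ι-recip : ∀ {z} → 0ℤ ℤ.< z → ∃ λ q → 0ℚ ℚ.< q × q ℚ.* ι z ≡ 1ℚ
  ι-recip {z} z>0 = ℚ.1/ ι z , ℚ.positive⁻¹ (ℚ.1/ ι z) {{ℚ.1/pos⇒pos (ι z)}} , ℚ.*-inverseˡ (ι z)
    where
    instance
      ιz-positive : ℚ.Positive (ι z)
      ιz-positive = ℚ.positive (ι-mono-< z>0)
      ιz-nonZero : ℚ.NonZero (ι z)
      ιz-nonZero = ℚ.pos⇒nonZero (ι z)

ι-nonneg : ∀ {z} → 0ℤ ℤ.≤ z → 0ℚ ℚ.≤ ι z
ι-nonneg {z} z≥0 = subst (ℚ._≤ ι z) ι-0 (ι-mono-≤ z≥0)

ι-pos : ∀ {z} → 0ℤ ℤ.< z → 0ℚ ℚ.< ι z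
ι-pos {z} z>0 = subst (ℚ._< ι z) ι-0 (ι-mono-< z>0)

ι-nonpos : ∀ {z} → z ℤ.≤ 0ℤ → ι z ℚ.≤ 0ℚ
ι-nonpos {z} z≤0 = subst (ι z ℚ.≤_) ι-0 (ι-mono-≤ z≤0)

ι-injective : ∀ {y z} → ι y ≡ ι z → y ≡ z
ι-injective {y} {z} eq with y ℤ.≤? z | z ℤ.≤? y
... | yes y≤z | yes z≤y = ℤ.≤-antisym y≤z z≤y
... | no y≰z  | _       = contradiction (sym eq) (ℚ.<⇒≢ (ι-mono-< (ℤ.≰⇒> y≰z)))
... | _       | no z≰y  = contradiction eq (ℚ.<⇒≢ (ι-mono-< (ℤ.≰⇒> z≰y)))

ι-Σ : (f : Fin k → ℤ) → ι (Σℤ f) ≡ Σℚ (ι ∘ f)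
ι-Σ {zero}  f = ι-0
ι-Σ {suc _} f = trans (ι-+ (f zero) _) (cong (ι (f zero) ℚ.+_) (ι-Σ (f ∘ suc)))

Row : ℕ → Set
Row d = Vec ℤ (suc d)

dot : Row d → Row d → ℤ
dot ℓ z = Σℤ λ j → lookup ℓ j ℤ.* lookup z j

φ : Row d → Point d → ℚ
φ ℓ x = Σℚ λ j → ι (lookup ℓ j) ℚ.* x j

φ-cong : (ℓ : Row d) {x y : Point d} → x ≐ y → φ ℓ x ≡ φ ℓ y
φ-cong ℓ eq = Σ-cong λ j → cong (ι (lookup ℓ j) ℚ.*_) (eq j)

φ-comb : (ℓ : Row d) (w : Fin (suc d) → ℚ) (p : Fin (suc d) → Point d) →
  φ ℓ (comb w p) ≡ Σℚ (λ k → w k ℚ.* φ ℓ (p k))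
φ-comb ℓ w p = begin
  Σℚ (λ j → ι (lookup ℓ j) ℚ.* Σℚ (λ k → w k ℚ.* p k j))
    ≡⟨ Σ-cong (λ j → sym (Σ-*ˡ (ι (lookup ℓ j)) (λ k → w k ℚ.* p k j))) ⟩
  Σℚ (λ j → Σℚ (λ k → ι (lookup ℓ j) ℚ.* (w k ℚ.* p k j)))
    ≡⟨ Σ-swap (λ j k → ι (lookup ℓ j) ℚ.* (w k ℚ.* p k j)) ⟩
  Σℚ (λ k → Σℚ (λ j → ι (lookup ℓ j) ℚ.* (w k ℚ.* p k j)))
    ≡⟨ Σ-cong (λ k → trans
         (Σ-cong (λ j → solve 3 (λ a b c → a :* (b :* c) := b :* (a :* c)) refl
                           (ι (lookup ℓ j)) (w k) (p k j)))
         (Σ-*ˡ (w k) (λ j → ι (lookup ℓ j) ℚ.* p k j))) ⟩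
  Σℚ (λ k → w k ℚ.* φ ℓ (p k)) ∎
  where open ≡-Reasoning; open +-*-Solver

φ-ι : (ℓ z : Row d) (q : ℚ) → φ ℓ (λ j → ι (lookup z j) ℚ.* q) ≡ ι (dot ℓ z) ℚ.* q
φ-ι ℓ z q = begin
  Σℚ (λ j → ι (lookup ℓ j) ℚ.* (ι (lookup z j) ℚ.* q))
    ≡⟨ Σ-cong (λ j → trans (sym (ℚ.*-assoc (ι (lookup ℓ j)) (ι (lookup z j)) q))
                        (cong (ℚ._* q) (sym (ι-* (lookup ℓ j) (lookup z j))))) ⟩
  Σℚ (λ j → ι (lookup ℓ j ℤ.* lookup z j) ℚ.* q)
    ≡⟨ Σ-*ʳ (λ j → ι (lookup ℓ j ℤ.* lookup z j)) q ⟩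
  Σℚ (λ j → ι (lookup ℓ j ℤ.* lookup z j)) ℚ.* q
    ≡⟨ cong (ℚ._* q) (ι-Σ (λ j → lookup ℓ j ℤ.* lookup z j)) ⟨
  ι (dot ℓ z) ℚ.* q ∎
  where open ≡-Reasoning

negate : Row d → Row d
negate = Vec.map (λ z → ℤ.- z)

ι-neg : ∀ z → ι (ℤ.- z) ≡ ℚ.- ι z
ι-neg z = +-cancelʳ (ι z) (trans (sym (ι-+ (ℤ.- z) z))
  (trans (cong ι (ℤ.+-inverseˡ z)) (trans ι-0 (sym (ℚ.+-inverseˡ (ι z))))))

φ-negate : (ℓ : Row d) (x : Point d) → φ (negate ℓ) x ≡ ℚ.- φ ℓ x
φ-negate ℓ x = begin
  Σℚ (λ j → ι (lookup (negate ℓ) j) ℚ.* x j)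
    ≡⟨ Σ-cong (λ j → cong (ℚ._* x j) (trans (cong ι (Vec.lookup-map j (λ z → ℤ.- z) ℓ)) (ι-neg (lookup ℓ j)))) ⟩
  Σℚ (λ j → ℚ.- ι (lookup ℓ j) ℚ.* x j)
    ≡⟨ Σ-cong (λ j → solve 2 (λ a b → (:- a) :* b := con (ℚ.- 1ℚ) :* (a :* b)) refl (ι (lookup ℓ j)) (x j)) ⟩
  Σℚ (λ j → (ℚ.- 1ℚ) ℚ.* (ι (lookup ℓ j) ℚ.* x j))
    ≡⟨ Σ-*ˡ (ℚ.- 1ℚ) (λ j → ι (lookup ℓ j) ℚ.* x j) ⟩
  (ℚ.- 1ℚ) ℚ.* φ ℓ x
    ≡⟨ solve 1 (λ a → con (ℚ.- 1ℚ) :* a := :- a) refl (φ ℓ x) ⟩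
  ℚ.- φ ℓ x ∎
  where open ≡-Reasoning; open +-*-Solver

combination : List ℕ → List (Row d) → Fin (suc d) → ℤ
combination (c ∷ cs) (ℓ ∷ ℓs) j = + c ℤ.* lookup ℓ j ℤ.+ combination cs ℓs j
-- A coefficient list that ends early stands for zeros from there on, so certificates may stop at
-- their last nonzero entry.
combination _        _        j = 0ℤ

-- The easy half of Farkas' lemma, which makes the leaf certificates sound.
combination-nonneg : ∀ cs {ℓs : List (Row d)} (x : Point d) → All (λ ℓ → 0ℚ ℚ.≤ φ ℓ x) ℓs →
  0ℚ ℚ.≤ Σℚ (λ j → ι (combination cs ℓs j) ℚ.* x j)
combination-nonneg {d} [] x _ = ℚ.≤-reflexive (sym (Σ-0s {suc d}
  (λ j → trans (cong (ℚ._* x j) ι-0) (ℚ.*-zeroˡ (x j)))))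
combination-nonneg {d} (_ ∷ _) x [] = ℚ.≤-reflexive (sym (Σ-0s {suc d}
  (λ j → trans (cong (ℚ._* x j) ι-0) (ℚ.*-zeroˡ (x j)))))
combination-nonneg (c ∷ cs) {ℓ ∷ ℓs} x (ℓ≥0 ∷ ℓs≥0) = ℚ.≤-trans
  (ℚ.+-mono-≤ (*-nonneg (ι-nonneg (ℤ.+≤+ {n = c} ℕ.z≤n)) ℓ≥0) (combination-nonneg cs x ℓs≥0))
  (ℚ.≤-reflexive (sym split))
  where
  open ≡-Reasoning
  open +-*-Solver
  rest = combination cs ℓs
  split : Σℚ (λ j → ι (combination (c ∷ cs) (ℓ ∷ ℓs) j) ℚ.* x j) ≡
          ι (+ c) ℚ.* φ ℓ x ℚ.+ Σℚ (λ j → ι (rest j) ℚ.* x j)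
  split = begin
    Σℚ (λ j → ι (+ c ℤ.* lookup ℓ j ℤ.+ rest j) ℚ.* x j)
      ≡⟨ Σ-cong (λ j → cong (ℚ._* x j) (trans (ι-+ (+ c ℤ.* lookup ℓ j) (rest j))
                          (cong (ℚ._+ ι (rest j)) (ι-* (+ c) (lookup ℓ j))))) ⟩
    Σℚ (λ j → (ι (+ c) ℚ.* ι (lookup ℓ j) ℚ.+ ι (rest j)) ℚ.* x j)
      ≡⟨ Σ-cong (λ j → solve 4 (λ a b e y → (a :* b :+ e) :* y := a :* (b :* y) :+ e :* y) refl
                          (ι (+ c)) (ι (lookup ℓ j)) (ι (rest j)) (x j)) ⟩
    Σℚ (λ j → ι (+ c) ℚ.* (ι (lookup ℓ j) ℚ.* x j) ℚ.+ ι (rest j) ℚ.* x j)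
      ≡⟨ Σ-+ (λ j → ι (+ c) ℚ.* (ι (lookup ℓ j) ℚ.* x j)) (λ j → ι (rest j) ℚ.* x j) ⟩
    Σℚ (λ j → ι (+ c) ℚ.* (ι (lookup ℓ j) ℚ.* x j)) ℚ.+ Σℚ (λ j → ι (rest j) ℚ.* x j)
      ≡⟨ cong (ℚ._+ Σℚ (λ j → ι (rest j) ℚ.* x j)) (Σ-*ˡ (ι (+ c)) (λ j → ι (lookup ℓ j) ℚ.* x j)) ⟩
    ι (+ c) ℚ.* φ ℓ x ℚ.+ Σℚ (λ j → ι (rest j) ℚ.* x j) ∎

-- The base triangulation of Δ³

infix 5 ⟦_,_,_,_⟧
⟦_,_,_,_⟧ : {A : Set} → A → A → A → A → Vec A 4
⟦ a , b , c , e ⟧ = a ∷ b ∷ c ∷ e ∷ []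

-- 12 times the barycentric coordinates of the vertices
coords : Vec (Row 3) 8
coords = Vec.map (Vec.map (λ c → + c))
  (⟦ 12 , 0 , 0 , 0 ⟧ ∷ ⟦ 0 , 12 , 0 , 0 ⟧ ∷ ⟦ 0 , 0 , 12 , 0 ⟧ ∷ ⟦ 0 , 0 , 0 , 12 ⟧ ∷
   ⟦ 4 , 6 , 1 , 1 ⟧ ∷ ⟦ 1 , 1 , 4 , 6 ⟧ ∷ ⟦ 2 , 5 , 1 , 4 ⟧ ∷ ⟦ 1 , 4 , 2 , 5 ⟧ ∷ [])

-- With the removed facet 0123 these are 20 tetrahedra in which all 28 pairs of the 8 vertices are
-- edges. Each is listed in the order that makes `vol` positive. The involution exchanging 0 with 2,
-- 1 with 3, 4 with 5 and 6 with 7 preserves both this list and `coords`.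
tetrahedra : Vec (Vec (Fin 8) 4) 19
tetrahedra =
  (⟦ 0F , 1F , 2F , 4F ⟧ ∷ ⟦ 0F , 1F , 4F , 3F ⟧ ∷ ⟦ 0F , 2F , 3F , 5F ⟧ ∷ ⟦ 0F , 2F , 5F , 4F ⟧ ∷ ⟦ 0F , 3F , 4F , 6F ⟧ ∷
   ⟦ 0F , 3F , 7F , 5F ⟧ ∷ ⟦ 0F , 3F , 6F , 7F ⟧ ∷ ⟦ 0F , 4F , 5F , 6F ⟧ ∷ ⟦ 0F , 5F , 7F , 6F ⟧ ∷ ⟦ 1F , 2F , 5F , 3F ⟧ ∷
   ⟦ 1F , 2F , 4F , 6F ⟧ ∷ ⟦ 1F , 2F , 7F , 5F ⟧ ∷ ⟦ 1F , 2F , 6F , 7F ⟧ ∷ ⟦ 1F , 3F , 6F , 4F ⟧ ∷ ⟦ 1F , 3F , 5F , 7F ⟧ ∷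
   ⟦ 1F , 3F , 7F , 6F ⟧ ∷ ⟦ 2F , 4F , 7F , 5F ⟧ ∷ ⟦ 2F , 4F , 6F , 7F ⟧ ∷ ⟦ 4F , 5F , 6F , 7F ⟧ ∷ [])

tet : Fin 19 → Fin 4 → Fin 8
tet r k = lookup (lookup tetrahedra r) k

coord : Fin 8 → Row 3
coord = lookup coords

tetCoord : Fin 19 → Fin 4 → Row 3
tetCoord r k = coord (tet r k)

det₃ : (a₁ a₂ a₃ b₁ b₂ b₃ c₁ c₂ c₃ : ℤ) → ℤ
det₃ a₁ a₂ a₃ b₁ b₂ b₃ c₁ c₂ c₃ =
  a₁ ℤ.* (b₂ ℤ.* c₃ ℤ.- b₃ ℤ.* c₂) ℤ.- a₂ ℤ.* (b₁ ℤ.* c₃ ℤ.- b₃ ℤ.* c₁)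
    ℤ.+ a₃ ℤ.* (b₁ ℤ.* c₂ ℤ.- b₂ ℤ.* c₁)

-- the functional x ↦ det (x , a , b , c)
cross : Row 3 → Row 3 → Row 3 → Row 3
cross (a₀ ∷ a₁ ∷ a₂ ∷ a₃ ∷ []) (b₀ ∷ b₁ ∷ b₂ ∷ b₃ ∷ []) (c₀ ∷ c₁ ∷ c₂ ∷ c₃ ∷ []) =
  ⟦ det₃ a₁ a₂ a₃ b₁ b₂ b₃ c₁ c₂ c₃ , ℤ.- det₃ a₀ a₂ a₃ b₀ b₂ b₃ c₀ c₂ c₃
  , det₃ a₀ a₁ a₃ b₀ b₁ b₃ c₀ c₁ c₃ , ℤ.- det₃ a₀ a₁ a₂ b₀ b₁ b₂ c₀ c₁ c₂ ⟧

-- bary r k is vol r times the k-th barycentric coordinate with respect to facet r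
bary : Fin 19 → Fin 4 → Row 3
bary r k = lookup
  -- Cramer's rule: putting vertex `k` in front of row `k` gives an even permutation of the
  -- vertices, so no row needs a sign.
  ⟦ cross (v 1F) (v 2F) (v 3F) , cross (v 2F) (v 0F) (v 3F)
  , cross (v 0F) (v 1F) (v 3F) , cross (v 1F) (v 0F) (v 2F) ⟧ k
  where v = tetCoord r

vol : Fin 19 → ℤ
vol r = dot (bary r zero) (tetCoord r zero)

δ : ℤ → Fin k → Fin k → ℤ
δ z i j with i ≟ j
... | yes _ = z
... | no  _ = 0ℤ

-- Point location by the signs of the functionals bary r k. Entry k of the certificate
-- at leaf r is a pair (c , cs): c times bary r k is the combination with coefficients
-- cs ≥ 0 of the functionals known to be nonnegative there (latest first, then the
-- coordinates), so all points reaching the leaf lie in facet r.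
data Tree : Set where
  leaf : Fin 19 → Vec (ℕ × List ℕ) 4 → Tree
  cut  : Fin 19 → Fin 4 → Tree → Tree → Tree

-- Entry s of row r lists c ≥ 0 such that Σ_k c_k · bary r k is > 0 on the vertices of
-- facet r outside facet s, 0 on the shared ones, and ≤ 0 on facet s.
separator : Vec (Vec (Vec ℕ 4) 19) 19
separator =
  (⟦ 0 , 0 , 0 , 0 ⟧ ∷ ⟦ 0 , 0 , 1 , 0 ⟧ ∷ ⟦ 0 , 3 , 0 , 1 ⟧ ∷ ⟦ 0 , 1 , 0 , 0 ⟧ ∷
   ⟦ 0 , 1 , 1 , 0 ⟧ ∷ ⟦ 0 , 2 , 3 , 1 ⟧ ∷ ⟦ 0 , 3 , 1 , 1 ⟧ ∷ ⟦ 0 , 1 , 1 , 0 ⟧ ∷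
   ⟦ 0 , 3 , 1 , 1 ⟧ ∷ ⟦ 4 , 0 , 0 , 1 ⟧ ∷ ⟦ 1 , 0 , 0 , 0 ⟧ ∷ ⟦ 4 , 0 , 0 , 1 ⟧ ∷
   ⟦ 4 , 0 , 0 , 1 ⟧ ∷ ⟦ 1 , 0 , 1 , 0 ⟧ ∷ ⟦ 3 , 0 , 2 , 1 ⟧ ∷ ⟦ 3 , 0 , 2 , 1 ⟧ ∷
   ⟦ 1 , 1 , 0 , 0 ⟧ ∷ ⟦ 1 , 1 , 0 , 0 ⟧ ∷ ⟦ 1 , 1 , 1 , 0 ⟧ ∷ []) ∷
  (⟦ 0 , 0 , 0 , 1 ⟧ ∷ ⟦ 0 , 0 , 0 , 0 ⟧ ∷ ⟦ 0 , 3 , 1 , 0 ⟧ ∷ ⟦ 0 , 1 , 0 , 1 ⟧ ∷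
   ⟦ 0 , 1 , 0 , 0 ⟧ ∷ ⟦ 0 , 3 , 1 , 0 ⟧ ∷ ⟦ 0 , 12 , 1 , 0 ⟧ ∷ ⟦ 0 , 3 , 0 , 1 ⟧ ∷
   ⟦ 0 , 15 , 1 , 1 ⟧ ∷ ⟦ 4 , 0 , 1 , 0 ⟧ ∷ ⟦ 2 , 0 , 0 , 1 ⟧ ∷ ⟦ 4 , 0 , 1 , 1 ⟧ ∷
   ⟦ 8 , 0 , 1 , 1 ⟧ ∷ ⟦ 1 , 0 , 0 , 0 ⟧ ∷ ⟦ 4 , 0 , 1 , 0 ⟧ ∷ ⟦ 6 , 0 , 1 , 0 ⟧ ∷
   ⟦ 1 , 1 , 0 , 1 ⟧ ∷ ⟦ 1 , 1 , 0 , 1 ⟧ ∷ ⟦ 1 , 1 , 0 , 1 ⟧ ∷ []) ∷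
  (⟦ 0 , 0 , 3 , 1 ⟧ ∷ ⟦ 0 , 4 , 0 , 1 ⟧ ∷ ⟦ 0 , 0 , 0 , 0 ⟧ ∷ ⟦ 0 , 0 , 1 , 0 ⟧ ∷
   ⟦ 0 , 4 , 0 , 1 ⟧ ∷ ⟦ 0 , 1 , 0 , 0 ⟧ ∷ ⟦ 0 , 4 , 0 , 1 ⟧ ∷ ⟦ 0 , 1 , 1 , 0 ⟧ ∷
   ⟦ 0 , 1 , 1 , 0 ⟧ ∷ ⟦ 1 , 0 , 0 , 0 ⟧ ∷ ⟦ 1 , 0 , 3 , 1 ⟧ ∷ ⟦ 1 , 0 , 1 , 0 ⟧ ∷
   ⟦ 1 , 0 , 3 , 1 ⟧ ∷ ⟦ 2 , 3 , 0 , 1 ⟧ ∷ ⟦ 1 , 1 , 0 , 0 ⟧ ∷ ⟦ 2 , 3 , 0 , 1 ⟧ ∷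
   ⟦ 1 , 0 , 1 , 0 ⟧ ∷ ⟦ 1 , 0 , 3 , 1 ⟧ ∷ ⟦ 1 , 1 , 1 , 0 ⟧ ∷ []) ∷
  (⟦ 0 , 0 , 1 , 0 ⟧ ∷ ⟦ 0 , 4 , 1 , 0 ⟧ ∷ ⟦ 0 , 0 , 0 , 1 ⟧ ∷ ⟦ 0 , 0 , 0 , 0 ⟧ ∷
   ⟦ 0 , 4 , 1 , 0 ⟧ ∷ ⟦ 0 , 5 , 0 , 1 ⟧ ∷ ⟦ 0 , 36 , 1 , 7 ⟧ ∷ ⟦ 0 , 1 , 0 , 0 ⟧ ∷
   ⟦ 0 , 5 , 0 , 1 ⟧ ∷ ⟦ 4 , 0 , 0 , 1 ⟧ ∷ ⟦ 5 , 0 , 1 , 0 ⟧ ∷ ⟦ 4 , 0 , 0 , 1 ⟧ ∷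
   ⟦ 36 , 0 , 7 , 1 ⟧ ∷ ⟦ 2 , 3 , 1 , 0 ⟧ ∷ ⟦ 3 , 2 , 0 , 1 ⟧ ∷ ⟦ 5 , 5 , 1 , 1 ⟧ ∷
   ⟦ 1 , 0 , 0 , 0 ⟧ ∷ ⟦ 5 , 0 , 1 , 0 ⟧ ∷ ⟦ 1 , 1 , 0 , 0 ⟧ ∷ []) ∷
  (⟦ 0 , 4 , 0 , 1 ⟧ ∷ ⟦ 0 , 0 , 0 , 1 ⟧ ∷ ⟦ 0 , 0 , 2 , 1 ⟧ ∷ ⟦ 0 , 5 , 0 , 1 ⟧ ∷
   ⟦ 0 , 0 , 0 , 0 ⟧ ∷ ⟦ 0 , 0 , 2 , 1 ⟧ ∷ ⟦ 0 , 0 , 1 , 0 ⟧ ∷ ⟦ 0 , 1 , 0 , 0 ⟧ ∷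
   ⟦ 0 , 1 , 1 , 0 ⟧ ∷ ⟦ 48 , 0 , 15 , 7 ⟧ ∷ ⟦ 2 , 1 , 0 , 0 ⟧ ∷ ⟦ 6 , 4 , 1 , 1 ⟧ ∷
   ⟦ 8 , 1 , 1 , 0 ⟧ ∷ ⟦ 1 , 0 , 0 , 0 ⟧ ∷ ⟦ 12 , 0 , 3 , 1 ⟧ ∷ ⟦ 6 , 0 , 1 , 0 ⟧ ∷
   ⟦ 1 , 5 , 0 , 1 ⟧ ∷ ⟦ 1 , 1 , 0 , 0 ⟧ ∷ ⟦ 1 , 1 , 0 , 0 ⟧ ∷ []) ∷
  (⟦ 0 , 4 , 1 , 1 ⟧ ∷ ⟦ 0 , 0 , 1 , 3 ⟧ ∷ ⟦ 0 , 0 , 1 , 0 ⟧ ∷ ⟦ 0 , 6 , 1 , 0 ⟧ ∷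
   ⟦ 0 , 0 , 1 , 4 ⟧ ∷ ⟦ 0 , 0 , 0 , 0 ⟧ ∷ ⟦ 0 , 0 , 0 , 1 ⟧ ∷ ⟦ 0 , 76 , 1 , 0 ⟧ ∷
   ⟦ 0 , 1 , 0 , 0 ⟧ ∷ ⟦ 24 , 0 , 1 , 0 ⟧ ∷ ⟦ 1 , 9 , 1 , 3 ⟧ ∷ ⟦ 1 , 1 , 0 , 0 ⟧ ∷
   ⟦ 1 , 3 , 0 , 1 ⟧ ∷ ⟦ 1 , 0 , 1 , 4 ⟧ ∷ ⟦ 1 , 0 , 0 , 0 ⟧ ∷ ⟦ 1 , 0 , 0 , 1 ⟧ ∷
   ⟦ 1 , 1 , 0 , 0 ⟧ ∷ ⟦ 1 , 3 , 0 , 1 ⟧ ∷ ⟦ 1 , 5 , 0 , 0 ⟧ ∷ []) ∷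
  (⟦ 0 , 4 , 1 , 1 ⟧ ∷ ⟦ 0 , 0 , 1 , 8 ⟧ ∷ ⟦ 0 , 0 , 2 , 1 ⟧ ∷ ⟦ 0 , 9 , 2 , 1 ⟧ ∷
   ⟦ 0 , 0 , 0 , 1 ⟧ ∷ ⟦ 0 , 0 , 1 , 0 ⟧ ∷ ⟦ 0 , 0 , 0 , 0 ⟧ ∷ ⟦ 0 , 76 , 0 , 1 ⟧ ∷
   ⟦ 0 , 1 , 0 , 0 ⟧ ∷ ⟦ 28 , 0 , 4 , 1 ⟧ ∷ ⟦ 1 , 7 , 0 , 1 ⟧ ∷ ⟦ 4 , 4 , 1 , 0 ⟧ ∷
   ⟦ 1 , 1 , 0 , 0 ⟧ ∷ ⟦ 1 , 0 , 0 , 1 ⟧ ∷ ⟦ 8 , 0 , 1 , 0 ⟧ ∷ ⟦ 1 , 0 , 0 , 0 ⟧ ∷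
   ⟦ 1 , 5 , 1 , 0 ⟧ ∷ ⟦ 1 , 1 , 0 , 0 ⟧ ∷ ⟦ 1 , 5 , 0 , 0 ⟧ ∷ []) ∷
  (⟦ 0 , 0 , 1 , 1 ⟧ ∷ ⟦ 0 , 0 , 23 , 1 ⟧ ∷ ⟦ 0 , 4 , 0 , 3 ⟧ ∷ ⟦ 0 , 0 , 0 , 1 ⟧ ∷
   ⟦ 0 , 0 , 1 , 0 ⟧ ∷ ⟦ 0 , 18 , 0 , 1 ⟧ ∷ ⟦ 0 , 7 , 1 , 0 ⟧ ∷ ⟦ 0 , 0 , 0 , 0 ⟧ ∷
   ⟦ 0 , 1 , 0 , 0 ⟧ ∷ ⟦ 10 , 3 , 0 , 1 ⟧ ∷ ⟦ 5 , 0 , 1 , 0 ⟧ ∷ ⟦ 119 , 24 , 0 , 5 ⟧ ∷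
   ⟦ 36 , 1 , 7 , 0 ⟧ ∷ ⟦ 1 , 0 , 3 , 0 ⟧ ∷ ⟦ 11 , 3 , 0 , 1 ⟧ ∷ ⟦ 5 , 1 , 1 , 0 ⟧ ∷
   ⟦ 14 , 0 , 0 , 1 ⟧ ∷ ⟦ 6 , 0 , 1 , 0 ⟧ ∷ ⟦ 1 , 0 , 0 , 0 ⟧ ∷ []) ∷
  (⟦ 0 , 1 , 2 , 1 ⟧ ∷ ⟦ 0 , 23 , 8 , 1 ⟧ ∷ ⟦ 0 , 0 , 11 , 15 ⟧ ∷ ⟦ 0 , 0 , 1 , 1 ⟧ ∷
   ⟦ 0 , 19 , 6 , 0 ⟧ ∷ ⟦ 0 , 0 , 0 , 1 ⟧ ∷ ⟦ 0 , 1 , 0 , 0 ⟧ ∷ ⟦ 0 , 0 , 1 , 0 ⟧ ∷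
   ⟦ 0 , 0 , 0 , 0 ⟧ ∷ ⟦ 40 , 0 , 1 , 5 ⟧ ∷ ⟦ 1 , 1 , 1 , 0 ⟧ ∷ ⟦ 11 , 0 , 0 , 1 ⟧ ∷
   ⟦ 6 , 1 , 0 , 0 ⟧ ∷ ⟦ 4 , 23 , 7 , 0 ⟧ ∷ ⟦ 11 , 0 , 0 , 1 ⟧ ∷ ⟦ 4 , 1 , 0 , 0 ⟧ ∷
   ⟦ 14 , 0 , 0 , 1 ⟧ ∷ ⟦ 6 , 1 , 0 , 0 ⟧ ∷ ⟦ 1 , 0 , 0 , 0 ⟧ ∷ []) ∷
  (⟦ 0 , 0 , 1 , 3 ⟧ ∷ ⟦ 0 , 4 , 1 , 0 ⟧ ∷ ⟦ 1 , 0 , 0 , 0 ⟧ ∷ ⟦ 1 , 0 , 0 , 1 ⟧ ∷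
   ⟦ 1 , 4 , 1 , 0 ⟧ ∷ ⟦ 1 , 2 , 0 , 0 ⟧ ∷ ⟦ 1 , 8 , 1 , 0 ⟧ ∷ ⟦ 1 , 1 , 0 , 1 ⟧ ∷
   ⟦ 1 , 1 , 0 , 1 ⟧ ∷ ⟦ 0 , 0 , 0 , 0 ⟧ ∷ ⟦ 0 , 0 , 1 , 3 ⟧ ∷ ⟦ 0 , 0 , 0 , 1 ⟧ ∷
   ⟦ 0 , 0 , 1 , 12 ⟧ ∷ ⟦ 0 , 4 , 1 , 0 ⟧ ∷ ⟦ 0 , 1 , 0 , 0 ⟧ ∷ ⟦ 0 , 6 , 1 , 0 ⟧ ∷
   ⟦ 1 , 0 , 0 , 3 ⟧ ∷ ⟦ 1 , 0 , 1 , 15 ⟧ ∷ ⟦ 1 , 1 , 0 , 1 ⟧ ∷ []) ∷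
  (⟦ 0 , 0 , 0 , 1 ⟧ ∷ ⟦ 0 , 24 , 0 , 1 ⟧ ∷ ⟦ 4 , 0 , 1 , 1 ⟧ ∷ ⟦ 6 , 0 , 0 , 1 ⟧ ∷
   ⟦ 1 , 1 , 0 , 0 ⟧ ∷ ⟦ 9 , 1 , 3 , 1 ⟧ ∷ ⟦ 3 , 1 , 1 , 0 ⟧ ∷ ⟦ 1 , 1 , 0 , 0 ⟧ ∷
   ⟦ 3 , 1 , 1 , 0 ⟧ ∷ ⟦ 0 , 0 , 3 , 1 ⟧ ∷ ⟦ 0 , 0 , 0 , 0 ⟧ ∷ ⟦ 0 , 0 , 4 , 1 ⟧ ∷
   ⟦ 0 , 0 , 1 , 0 ⟧ ∷ ⟦ 0 , 1 , 0 , 0 ⟧ ∷ ⟦ 0 , 1 , 4 , 1 ⟧ ∷ ⟦ 0 , 1 , 1 , 0 ⟧ ∷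
   ⟦ 76 , 0 , 0 , 1 ⟧ ∷ ⟦ 1 , 0 , 0 , 0 ⟧ ∷ ⟦ 5 , 1 , 0 , 0 ⟧ ∷ []) ∷
  (⟦ 0 , 0 , 1 , 2 ⟧ ∷ ⟦ 0 , 48 , 7 , 15 ⟧ ∷ ⟦ 4 , 0 , 1 , 0 ⟧ ∷ ⟦ 5 , 0 , 1 , 0 ⟧ ∷
   ⟦ 4 , 6 , 1 , 1 ⟧ ∷ ⟦ 1 , 2 , 0 , 0 ⟧ ∷ ⟦ 1 , 8 , 0 , 1 ⟧ ∷ ⟦ 5 , 1 , 1 , 0 ⟧ ∷
   ⟦ 1 , 1 , 0 , 0 ⟧ ∷ ⟦ 0 , 0 , 1 , 0 ⟧ ∷ ⟦ 0 , 0 , 1 , 2 ⟧ ∷ ⟦ 0 , 0 , 0 , 0 ⟧ ∷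
   ⟦ 0 , 0 , 0 , 1 ⟧ ∷ ⟦ 0 , 12 , 1 , 3 ⟧ ∷ ⟦ 0 , 1 , 0 , 0 ⟧ ∷ ⟦ 0 , 6 , 0 , 1 ⟧ ∷
   ⟦ 1 , 0 , 0 , 0 ⟧ ∷ ⟦ 1 , 0 , 0 , 1 ⟧ ∷ ⟦ 1 , 1 , 0 , 0 ⟧ ∷ []) ∷
  (⟦ 0 , 0 , 1 , 2 ⟧ ∷ ⟦ 0 , 28 , 1 , 4 ⟧ ∷ ⟦ 4 , 0 , 1 , 1 ⟧ ∷ ⟦ 9 , 0 , 1 , 2 ⟧ ∷
   ⟦ 4 , 4 , 0 , 1 ⟧ ∷ ⟦ 7 , 1 , 1 , 0 ⟧ ∷ ⟦ 1 , 1 , 0 , 0 ⟧ ∷ ⟦ 5 , 1 , 0 , 1 ⟧ ∷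
   ⟦ 1 , 1 , 0 , 0 ⟧ ∷ ⟦ 0 , 0 , 8 , 1 ⟧ ∷ ⟦ 0 , 0 , 0 , 1 ⟧ ∷ ⟦ 0 , 0 , 1 , 0 ⟧ ∷
   ⟦ 0 , 0 , 0 , 0 ⟧ ∷ ⟦ 0 , 8 , 0 , 1 ⟧ ∷ ⟦ 0 , 1 , 1 , 0 ⟧ ∷ ⟦ 0 , 1 , 0 , 0 ⟧ ∷
   ⟦ 76 , 0 , 1 , 0 ⟧ ∷ ⟦ 1 , 0 , 0 , 0 ⟧ ∷ ⟦ 5 , 1 , 0 , 0 ⟧ ∷ []) ∷
  (⟦ 0 , 4 , 1 , 0 ⟧ ∷ ⟦ 0 , 0 , 1 , 0 ⟧ ∷ ⟦ 4 , 0 , 1 , 1 ⟧ ∷ ⟦ 2 , 3 , 1 , 0 ⟧ ∷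
   ⟦ 1 , 0 , 0 , 0 ⟧ ∷ ⟦ 6 , 0 , 1 , 1 ⟧ ∷ ⟦ 12 , 0 , 0 , 1 ⟧ ∷ ⟦ 3 , 1 , 0 , 0 ⟧ ∷
   ⟦ 15 , 1 , 0 , 1 ⟧ ∷ ⟦ 0 , 0 , 1 , 3 ⟧ ∷ ⟦ 0 , 1 , 0 , 0 ⟧ ∷ ⟦ 0 , 1 , 1 , 2 ⟧ ∷
   ⟦ 0 , 1 , 0 , 1 ⟧ ∷ ⟦ 0 , 0 , 0 , 0 ⟧ ∷ ⟦ 0 , 0 , 1 , 3 ⟧ ∷ ⟦ 0 , 0 , 0 , 1 ⟧ ∷
   ⟦ 3 , 4 , 1 , 0 ⟧ ∷ ⟦ 1 , 1 , 0 , 0 ⟧ ∷ ⟦ 1 , 1 , 0 , 0 ⟧ ∷ []) ∷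
  (⟦ 0 , 4 , 1 , 1 ⟧ ∷ ⟦ 0 , 0 , 3 , 1 ⟧ ∷ ⟦ 4 , 0 , 0 , 1 ⟧ ∷ ⟦ 3 , 2 , 0 , 1 ⟧ ∷
   ⟦ 1 , 0 , 2 , 1 ⟧ ∷ ⟦ 1 , 0 , 0 , 0 ⟧ ∷ ⟦ 1 , 0 , 1 , 0 ⟧ ∷ ⟦ 4 , 3 , 0 , 1 ⟧ ∷
   ⟦ 1 , 1 , 0 , 0 ⟧ ∷ ⟦ 0 , 0 , 0 , 1 ⟧ ∷ ⟦ 0 , 6 , 1 , 1 ⟧ ∷ ⟦ 0 , 1 , 0 , 0 ⟧ ∷
   ⟦ 0 , 12 , 1 , 0 ⟧ ∷ ⟦ 0 , 0 , 3 , 1 ⟧ ∷ ⟦ 0 , 0 , 0 , 0 ⟧ ∷ ⟦ 0 , 0 , 1 , 0 ⟧ ∷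
   ⟦ 1 , 3 , 0 , 0 ⟧ ∷ ⟦ 1 , 15 , 1 , 0 ⟧ ∷ ⟦ 1 , 1 , 0 , 0 ⟧ ∷ []) ∷
  (⟦ 0 , 4 , 1 , 1 ⟧ ∷ ⟦ 0 , 0 , 4 , 1 ⟧ ∷ ⟦ 4 , 0 , 1 , 1 ⟧ ∷ ⟦ 3 , 3 , 1 , 1 ⟧ ∷
   ⟦ 1 , 0 , 1 , 0 ⟧ ∷ ⟦ 4 , 0 , 0 , 1 ⟧ ∷ ⟦ 1 , 0 , 0 , 0 ⟧ ∷ ⟦ 4 , 3 , 1 , 0 ⟧ ∷
   ⟦ 1 , 1 , 0 , 0 ⟧ ∷ ⟦ 0 , 0 , 1 , 4 ⟧ ∷ ⟦ 0 , 4 , 1 , 0 ⟧ ∷ ⟦ 0 , 1 , 0 , 1 ⟧ ∷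
   ⟦ 0 , 1 , 0 , 0 ⟧ ∷ ⟦ 0 , 0 , 1 , 0 ⟧ ∷ ⟦ 0 , 0 , 0 , 1 ⟧ ∷ ⟦ 0 , 0 , 0 , 0 ⟧ ∷
   ⟦ 3 , 4 , 0 , 1 ⟧ ∷ ⟦ 1 , 1 , 0 , 0 ⟧ ∷ ⟦ 1 , 1 , 0 , 0 ⟧ ∷ []) ∷
  (⟦ 0 , 0 , 3 , 4 ⟧ ∷ ⟦ 10 , 0 , 1 , 3 ⟧ ∷ ⟦ 0 , 1 , 1 , 0 ⟧ ∷ ⟦ 0 , 0 , 1 , 0 ⟧ ∷
   ⟦ 119 , 0 , 5 , 24 ⟧ ∷ ⟦ 5 , 1 , 0 , 0 ⟧ ∷ ⟦ 36 , 7 , 0 , 1 ⟧ ∷ ⟦ 14 , 0 , 1 , 0 ⟧ ∷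
   ⟦ 6 , 1 , 0 , 0 ⟧ ∷ ⟦ 0 , 23 , 1 , 0 ⟧ ∷ ⟦ 0 , 0 , 1 , 18 ⟧ ∷ ⟦ 0 , 1 , 0 , 0 ⟧ ∷
   ⟦ 0 , 1 , 0 , 7 ⟧ ∷ ⟦ 11 , 0 , 1 , 3 ⟧ ∷ ⟦ 1 , 3 , 0 , 0 ⟧ ∷ ⟦ 5 , 1 , 0 , 1 ⟧ ∷
   ⟦ 0 , 0 , 0 , 0 ⟧ ∷ ⟦ 0 , 0 , 0 , 1 ⟧ ∷ ⟦ 1 , 0 , 0 , 0 ⟧ ∷ []) ∷
  (⟦ 0 , 0 , 11 , 15 ⟧ ∷ ⟦ 40 , 0 , 1 , 5 ⟧ ∷ ⟦ 0 , 1 , 2 , 1 ⟧ ∷ ⟦ 0 , 0 , 1 , 1 ⟧ ∷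
   ⟦ 11 , 0 , 0 , 1 ⟧ ∷ ⟦ 1 , 1 , 1 , 0 ⟧ ∷ ⟦ 6 , 1 , 0 , 0 ⟧ ∷ ⟦ 14 , 0 , 0 , 1 ⟧ ∷
   ⟦ 6 , 1 , 0 , 0 ⟧ ∷ ⟦ 0 , 23 , 8 , 1 ⟧ ∷ ⟦ 0 , 0 , 0 , 1 ⟧ ∷ ⟦ 0 , 19 , 6 , 0 ⟧ ∷
   ⟦ 0 , 1 , 0 , 0 ⟧ ∷ ⟦ 11 , 0 , 0 , 1 ⟧ ∷ ⟦ 4 , 23 , 7 , 0 ⟧ ∷ ⟦ 4 , 1 , 0 , 0 ⟧ ∷
   ⟦ 0 , 0 , 1 , 0 ⟧ ∷ ⟦ 0 , 0 , 0 , 0 ⟧ ∷ ⟦ 1 , 0 , 0 , 0 ⟧ ∷ []) ∷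
  (⟦ 0 , 2 , 3 , 3 ⟧ ∷ ⟦ 0 , 9 , 1 , 4 ⟧ ∷ ⟦ 2 , 0 , 3 , 3 ⟧ ∷ ⟦ 0 , 0 , 1 , 1 ⟧ ∷
   ⟦ 0 , 1 , 0 , 1 ⟧ ∷ ⟦ 18 , 0 , 1 , 0 ⟧ ∷ ⟦ 7 , 1 , 0 , 0 ⟧ ∷ ⟦ 0 , 0 , 0 , 1 ⟧ ∷
   ⟦ 1 , 0 , 0 , 0 ⟧ ∷ ⟦ 9 , 0 , 4 , 1 ⟧ ∷ ⟦ 0 , 18 , 0 , 1 ⟧ ∷ ⟦ 1 , 0 , 1 , 0 ⟧ ∷
   ⟦ 1 , 7 , 0 , 0 ⟧ ∷ ⟦ 0 , 3 , 0 , 1 ⟧ ∷ ⟦ 3 , 0 , 1 , 0 ⟧ ∷ ⟦ 1 , 1 , 0 , 0 ⟧ ∷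
   ⟦ 0 , 0 , 1 , 0 ⟧ ∷ ⟦ 0 , 1 , 0 , 0 ⟧ ∷ ⟦ 0 , 0 , 0 , 0 ⟧ ∷ []) ∷ []

-- The space is cut along planes spanned by faces of the tetrahedra, and one facet may occupy
-- several leaves. The coefficient 1728 is 12 cubed: a face spanned by three corners lies in the
-- boundary, where the functional is 1728 times a coordinate.
searchTree : Tree
searchTree =
  (cut (# 6) (# 1)
   (cut (# 2) (# 1)
    (cut (# 2) (# 0)
     (leaf (# 2) ⟦ (1 , 1 ∷ [])
       , (1 , 0 ∷ 1 ∷ [])
       , (2 , 0 ∷ 3 ∷ 4 ∷ 0 ∷ 144 ∷ [])
       , (1 , 0 ∷ 0 ∷ 0 ∷ 0 ∷ 1728 ∷ []) ⟧)
     (leaf (# 9) ⟦ (1 , 1 ∷ [])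
       , (1 , 4 ∷ 1 ∷ [])
       , (1 , 0 ∷ 0 ∷ 0 ∷ 1728 ∷ [])
       , (2 , 13 ∷ 3 ∷ 4 ∷ 144 ∷ []) ⟧))
    (cut (# 9) (# 1)
     (leaf (# 9) ⟦ (4 , 1 ∷ 1 ∷ [])
       , (1 , 1 ∷ [])
       , (1 , 0 ∷ 0 ∷ 0 ∷ 1728 ∷ [])
       , (2 , 3 ∷ 0 ∷ 4 ∷ 0 ∷ 144 ∷ []) ⟧)
     (cut (# 5) (# 3)
      (cut (# 5) (# 0)
       (leaf (# 5) ⟦ (1 , 1 ∷ [])
         , (24 , 0 ∷ 1 ∷ 0 ∷ 0 ∷ 56 ∷ [])
         , (1 , 0 ∷ 0 ∷ 0 ∷ 1 ∷ [])
         , (1 , 0 ∷ 1 ∷ []) ⟧)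
       (leaf (# 14) ⟦ (1 , 1 ∷ [])
         , (168 , 96 ∷ 1 ∷ 0 ∷ 0 ∷ 56 ∷ [])
         , (7 , 12 ∷ 1 ∷ [])
         , (1 , 0 ∷ 0 ∷ 1 ∷ []) ⟧))
      (cut (# 14) (# 2)
       (leaf (# 14) ⟦ (12 , 7 ∷ 1 ∷ [])
         , (24 , 8 ∷ 1 ∷ 0 ∷ 0 ∷ 8 ∷ [])
         , (1 , 1 ∷ [])
         , (1 , 0 ∷ 0 ∷ 1 ∷ []) ⟧)
       (cut (# 4) (# 2)
        (cut (# 13) (# 3)
         (cut (# 1) (# 1)
          (cut (# 1) (# 0)
           (leaf (# 1) ⟦ (1 , 1 ∷ [])
             , (1 , 0 ∷ 1 ∷ [])
             , (1 , 0 ∷ 0 ∷ 0 ∷ 0 ∷ 0 ∷ 0 ∷ 0 ∷ 0 ∷ 0 ∷ 0 ∷ 0 ∷ 1728 ∷ [])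
             , (2 , 0 ∷ 1 ∷ 0 ∷ 0 ∷ 0 ∷ 0 ∷ 0 ∷ 0 ∷ 4 ∷ 0 ∷ 0 ∷ 1008 ∷ []) ⟧)
           (leaf (# 13) ⟦ (12 , 1 ∷ 2 ∷ [])
             , (12 , 0 ∷ 0 ∷ 3 ∷ 1 ∷ 0 ∷ 0 ∷ 0 ∷ 0 ∷ 4 ∷ [])
             , (1 , 1 ∷ [])
             , (1 , 0 ∷ 0 ∷ 1 ∷ []) ⟧))
          (cut (# 4) (# 0)
           (leaf (# 4) ⟦ (1 , 1 ∷ [])
             , (24 , 0 ∷ 0 ∷ 0 ∷ 7 ∷ 0 ∷ 0 ∷ 0 ∷ 0 ∷ 4 ∷ [])
             , (1 , 0 ∷ 0 ∷ 0 ∷ 1 ∷ [])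
             , (1 , 0 ∷ 1 ∷ []) ⟧)
           (leaf (# 13) ⟦ (1 , 1 ∷ [])
             , (24 , 12 ∷ 0 ∷ 7 ∷ 0 ∷ 0 ∷ 0 ∷ 0 ∷ 0 ∷ 8 ∷ [])
             , (1 , 12 ∷ 2 ∷ [])
             , (1 , 0 ∷ 0 ∷ 1 ∷ []) ⟧)))
         (leaf (# 15) ⟦ (4 , 2 ∷ 1 ∷ [])
           , (8 , 2 ∷ 1 ∷ 0 ∷ 0 ∷ 0 ∷ 0 ∷ 4 ∷ [])
           , (1 , 1 ∷ [])
           , (1 , 0 ∷ 0 ∷ 1 ∷ []) ⟧))
        (cut (# 6) (# 0)
         (leaf (# 6) ⟦ (1 , 1 ∷ [])
           , (1 , 0 ∷ 0 ∷ 0 ∷ 0 ∷ 0 ∷ 0 ∷ 1 ∷ [])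
           , (1 , 0 ∷ 0 ∷ 0 ∷ 1 ∷ [])
           , (1 , 0 ∷ 1 ∷ []) ⟧)
         (leaf (# 15) ⟦ (1 , 1 ∷ [])
           , (2 , 1 ∷ 0 ∷ 0 ∷ 0 ∷ 0 ∷ 0 ∷ 1 ∷ [])
           , (2 , 4 ∷ 1 ∷ [])
           , (1 , 0 ∷ 0 ∷ 1 ∷ []) ⟧)))))))
   (cut (# 2) (# 2)
    (cut (# 2) (# 1)
     (cut (# 2) (# 0)
      (leaf (# 2) ⟦ (1 , 1 ∷ [])
        , (1 , 0 ∷ 1 ∷ [])
        , (1 , 0 ∷ 0 ∷ 1 ∷ [])
        , (1 , 0 ∷ 0 ∷ 0 ∷ 0 ∷ 0 ∷ 1728 ∷ []) ⟧)
      (leaf (# 9) ⟦ (1 , 1 ∷ [])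
        , (1 , 4 ∷ 1 ∷ [])
        , (1 , 0 ∷ 0 ∷ 0 ∷ 0 ∷ 1728 ∷ [])
        , (1 , 6 ∷ 0 ∷ 1 ∷ []) ⟧))
     (cut (# 5) (# 0)
      (leaf (# 5) ⟦ (1 , 1 ∷ [])
        , (12 , 0 ∷ 19 ∷ 14 ∷ [])
        , (1 , 0 ∷ 1 ∷ [])
        , (1 , 0 ∷ 38 ∷ 28 ∷ 56 ∷ []) ⟧)
      (cut (# 9) (# 1)
       (leaf (# 9) ⟦ (4 , 1 ∷ 0 ∷ 1 ∷ [])
         , (1 , 1 ∷ [])
         , (1 , 0 ∷ 0 ∷ 0 ∷ 0 ∷ 0 ∷ 1728 ∷ [])
         , (2 , 3 ∷ 0 ∷ 3 ∷ 2 ∷ []) ⟧)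
       (leaf (# 14) ⟦ (1 , 0 ∷ 1 ∷ [])
         , (12 , 19 ∷ 72 ∷ 0 ∷ 2 ∷ [])
         , (1 , 38 ∷ 132 ∷ 0 ∷ 4 ∷ 8 ∷ [])
         , (1 , 1 ∷ []) ⟧))))
    (cut (# 5) (# 1)
     (cut (# 5) (# 0)
      (leaf (# 5) ⟦ (1 , 1 ∷ [])
        , (1 , 0 ∷ 1 ∷ [])
        , (19 , 0 ∷ 12 ∷ 14 ∷ [])
        , (1 , 0 ∷ 24 ∷ 0 ∷ 56 ∷ []) ⟧)
      (cut (# 9) (# 1)
       (leaf (# 9) ⟦ (76 , 19 ∷ 0 ∷ 12 ∷ 14 ∷ [])
         , (1 , 1 ∷ [])
         , (1 , 0 ∷ 0 ∷ 0 ∷ 0 ∷ 0 ∷ 1728 ∷ [])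
         , (14 , 7 ∷ 48 ∷ 12 ∷ []) ⟧)
       (leaf (# 14) ⟦ (1 , 0 ∷ 1 ∷ [])
         , (7 , 0 ∷ 4 ∷ 1 ∷ [])
         , (7 , 0 ∷ 12 ∷ 24 ∷ 0 ∷ 56 ∷ [])
         , (1 , 1 ∷ []) ⟧)))
     (cut (# 11) (# 1)
      (cut (# 9) (# 3)
       (leaf (# 9) ⟦ (6 , 1 ∷ 0 ∷ 0 ∷ 1 ∷ [])
         , (1 , 2 ∷ 12 ∷ [])
         , (1 , 0 ∷ 0 ∷ 0 ∷ 0 ∷ 0 ∷ 1728 ∷ [])
         , (1 , 1 ∷ []) ⟧)
       (cut (# 12) (# 1)
        (cut (# 10) (# 1)
         (cut (# 0) (# 0)
          (cut (# 0) (# 1)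
           (leaf (# 0) ⟦ (1 , 0 ∷ 1 ∷ [])
             , (1 , 1 ∷ [])
             , (14 , 0 ∷ 3 ∷ 12 ∷ [])
             , (1 , 0 ∷ 0 ∷ 0 ∷ 0 ∷ 0 ∷ 0 ∷ 0 ∷ 0 ∷ 0 ∷ 0 ∷ 0 ∷ 0 ∷ 1728 ∷ []) ⟧)
           (leaf (# 3) ⟦ (12 , 23 ∷ 35 ∷ [])
             , (24 , 4 ∷ 15 ∷ 60 ∷ [])
             , (1 , 1 ∷ [])
             , (1 , 0 ∷ 0 ∷ 0 ∷ 0 ∷ 0 ∷ 0 ∷ 0 ∷ 1 ∷ []) ⟧))
          (cut (# 8) (# 0)
           (cut (# 3) (# 1)
            (leaf (# 3) ⟦ (51 , 69 ∷ 1380 ∷ 0 ∷ 0 ∷ 0 ∷ 20 ∷ [])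
              , (1 , 1 ∷ [])
              , (531 , 36 ∷ 8400 ∷ 735 ∷ 0 ∷ 2240 ∷ [])
              , (1 , 0 ∷ 0 ∷ 0 ∷ 0 ∷ 0 ∷ 0 ∷ 0 ∷ 0 ∷ 1 ∷ []) ⟧)
            (cut (# 7) (# 1)
             (leaf (# 7) ⟦ (3 , 4 ∷ 0 ∷ 67 ∷ [])
               , (1 , 1 ∷ [])
               , (41 , 48 ∷ 0 ∷ 804 ∷ 0 ∷ 67 ∷ [])
               , (1 , 0 ∷ 1 ∷ []) ⟧)
             (leaf (# 8) ⟦ (1 , 0 ∷ 0 ∷ 1 ∷ [])
               , (1 , 0 ∷ 0 ∷ 0 ∷ 0 ∷ 0 ∷ 0 ∷ 0 ∷ 0 ∷ 0 ∷ 0 ∷ 1 ∷ [])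
               , (1 , 1 ∷ [])
               , (1 , 0 ∷ 0 ∷ 0 ∷ 0 ∷ 0 ∷ 0 ∷ 0 ∷ 0 ∷ 1 ∷ []) ⟧)))
           (cut (# 3) (# 0)
            (cut (# 3) (# 1)
             (leaf (# 3) ⟦ (1 , 0 ∷ 1 ∷ [])
               , (1 , 1 ∷ [])
               , (23 , 0 ∷ 12 ∷ 0 ∷ 35 ∷ [])
               , (1 , 0 ∷ 0 ∷ 0 ∷ 0 ∷ 0 ∷ 0 ∷ 0 ∷ 0 ∷ 0 ∷ 1 ∷ []) ⟧)
             (leaf (# 7) ⟦ (420 , 53 ∷ 67 ∷ [])
               , (560 , 53 ∷ 67 ∷ 9380 ∷ [])
               , (1435 , 159 ∷ 201 ∷ 0 ∷ 0 ∷ 2345 ∷ [])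
               , (1 , 1 ∷ []) ⟧))
            (cut (# 7) (# 0)
             (leaf (# 7) ⟦ (1 , 1 ∷ [])
               , (4 , 3 ∷ 0 ∷ 67 ∷ [])
               , (41 , 36 ∷ 0 ∷ 0 ∷ 0 ∷ 67 ∷ [])
               , (53 , 420 ∷ 67 ∷ []) ⟧)
             (cut (# 16) (# 3)
              (cut (# 16) (# 0)
               (cut (# 11) (# 0)
                (leaf (# 11) ⟦ (1 , 1 ∷ [])
                  , (1 , 0 ∷ 0 ∷ 0 ∷ 0 ∷ 0 ∷ 0 ∷ 0 ∷ 0 ∷ 0 ∷ 0 ∷ 1 ∷ [])
                  , (1 , 0 ∷ 0 ∷ 0 ∷ 0 ∷ 0 ∷ 0 ∷ 0 ∷ 0 ∷ 0 ∷ 1 ∷ [])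
                  , (67 , 228 ∷ 0 ∷ 12 ∷ []) ⟧)
                (leaf (# 16) ⟦ (1 , 0 ∷ 1 ∷ [])
                  , (1 , 1 ∷ [])
                  , (1 , 0 ∷ 0 ∷ 0 ∷ 0 ∷ 1 ∷ [])
                  , (1 , 0 ∷ 0 ∷ 1 ∷ []) ⟧))
               (leaf (# 18) ⟦ (1 , 0 ∷ 0 ∷ 0 ∷ 0 ∷ 1 ∷ [])
                 , (67 , 3 ∷ 4 ∷ [])
                 , (1 , 1 ∷ [])
                 , (1 , 0 ∷ 0 ∷ 1 ∷ []) ⟧))
              (cut (# 11) (# 3)
               (leaf (# 11) ⟦ (228 , 67 ∷ 12 ∷ [])
                 , (1 , 0 ∷ 0 ∷ 0 ∷ 0 ∷ 0 ∷ 0 ∷ 0 ∷ 0 ∷ 0 ∷ 1 ∷ [])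
                 , (1 , 0 ∷ 0 ∷ 0 ∷ 0 ∷ 0 ∷ 0 ∷ 0 ∷ 0 ∷ 1 ∷ [])
                 , (1 , 1 ∷ []) ⟧)
               (cut (# 17) (# 0)
                (cut (# 10) (# 2)
                 (cut (# 10) (# 0)
                  (leaf (# 10) ⟦ (1 , 1 ∷ [])
                    , (1 , 0 ∷ 0 ∷ 0 ∷ 0 ∷ 0 ∷ 0 ∷ 0 ∷ 0 ∷ 0 ∷ 1 ∷ [])
                    , (1 , 0 ∷ 1 ∷ [])
                    , (1 , 0 ∷ 0 ∷ 0 ∷ 0 ∷ 0 ∷ 0 ∷ 0 ∷ 0 ∷ 1 ∷ []) ⟧)
                  (leaf (# 17) ⟦ (1 , 0 ∷ 0 ∷ 1 ∷ [])
                    , (56 , 24 ∷ 1 ∷ [])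
                    , (1 , 0 ∷ 0 ∷ 0 ∷ 0 ∷ 1 ∷ [])
                    , (1 , 1 ∷ []) ⟧))
                 (cut (# 12) (# 0)
                  (leaf (# 12) ⟦ (1 , 1 ∷ [])
                    , (1 , 0 ∷ 0 ∷ 0 ∷ 0 ∷ 0 ∷ 0 ∷ 0 ∷ 0 ∷ 0 ∷ 0 ∷ 1 ∷ [])
                    , (1 , 0 ∷ 0 ∷ 0 ∷ 1 ∷ [])
                    , (1 , 0 ∷ 1 ∷ []) ⟧)
                  (leaf (# 17) ⟦ (1 , 0 ∷ 0 ∷ 1 ∷ [])
                    , (1 , 1 ∷ [])
                    , (1 , 0 ∷ 0 ∷ 0 ∷ 0 ∷ 1 ∷ [])
                    , (24 , 56 ∷ 1 ∷ []) ⟧)))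
                (leaf (# 18) ⟦ (1 , 0 ∷ 0 ∷ 0 ∷ 0 ∷ 0 ∷ 1 ∷ [])
                  , (1 , 1 ∷ [])
                  , (3 , 67 ∷ 0 ∷ 4 ∷ [])
                  , (1 , 0 ∷ 0 ∷ 0 ∷ 1 ∷ []) ⟧))))))))
         (cut (# 7) (# 1)
          (cut (# 4) (# 1)
           (cut (# 0) (# 2)
            (leaf (# 0) ⟦ (3 , 14 ∷ 0 ∷ 0 ∷ 12 ∷ [])
              , (3 , 19 ∷ 12 ∷ [])
              , (1 , 1 ∷ [])
              , (1 , 0 ∷ 0 ∷ 0 ∷ 0 ∷ 0 ∷ 0 ∷ 0 ∷ 0 ∷ 0 ∷ 0 ∷ 0 ∷ 0 ∷ 0 ∷ 1728 ∷ []) ⟧)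
            (cut (# 1) (# 1)
             (cut (# 1) (# 0)
              (leaf (# 1) ⟦ (1 , 1 ∷ [])
                , (1 , 0 ∷ 1 ∷ [])
                , (1 , 0 ∷ 0 ∷ 0 ∷ 0 ∷ 0 ∷ 0 ∷ 0 ∷ 0 ∷ 0 ∷ 0 ∷ 0 ∷ 0 ∷ 0 ∷ 0 ∷ 1728 ∷ [])
                , (1 , 0 ∷ 0 ∷ 1 ∷ []) ⟧)
              (leaf (# 13) ⟦ (12 , 1 ∷ 2 ∷ [])
                , (1 , 0 ∷ 0 ∷ 0 ∷ 0 ∷ 0 ∷ 1 ∷ [])
                , (1 , 1 ∷ [])
                , (5 , 0 ∷ 0 ∷ 0 ∷ 0 ∷ 0 ∷ 12 ∷ 8 ∷ []) ⟧))
             (cut (# 4) (# 0)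
              (leaf (# 4) ⟦ (1 , 1 ∷ [])
                , (1 , 0 ∷ 0 ∷ 0 ∷ 1 ∷ [])
                , (67 , 0 ∷ 0 ∷ 0 ∷ 228 ∷ 12 ∷ [])
                , (1 , 0 ∷ 1 ∷ []) ⟧)
              (leaf (# 13) ⟦ (1 , 1 ∷ [])
                , (1 , 0 ∷ 0 ∷ 0 ∷ 0 ∷ 0 ∷ 1 ∷ [])
                , (1 , 12 ∷ 2 ∷ [])
                , (5 , 0 ∷ 0 ∷ 0 ∷ 0 ∷ 0 ∷ 12 ∷ 8 ∷ []) ⟧))))
           (cut (# 3) (# 1)
            (cut (# 0) (# 1)
             (leaf (# 0) ⟦ (15 , 4 ∷ 24 ∷ 0 ∷ 0 ∷ 60 ∷ [])
               , (1 , 1 ∷ [])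
               , (35 , 2 ∷ 12 ∷ [])
               , (1 , 0 ∷ 0 ∷ 0 ∷ 0 ∷ 0 ∷ 0 ∷ 0 ∷ 0 ∷ 0 ∷ 0 ∷ 0 ∷ 0 ∷ 0 ∷ 0 ∷ 1728 ∷ []) ⟧)
             (leaf (# 3) ⟦ (36 , 41 ∷ 168 ∷ 0 ∷ 0 ∷ 420 ∷ [])
               , (1 , 0 ∷ 1 ∷ [])
               , (1 , 1 ∷ [])
               , (1 , 0 ∷ 0 ∷ 0 ∷ 0 ∷ 0 ∷ 0 ∷ 0 ∷ 0 ∷ 0 ∷ 1 ∷ []) ⟧))
            (leaf (# 7) ⟦ (36 , 0 ∷ 41 ∷ 0 ∷ 67 ∷ [])
              , (1 , 0 ∷ 0 ∷ 1 ∷ [])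
              , (1 , 0 ∷ 1 ∷ [])
              , (1 , 1 ∷ []) ⟧)))
          (leaf (# 8) ⟦ (600 , 45 ∷ 9 ∷ 41 ∷ [])
            , (1 , 0 ∷ 0 ∷ 0 ∷ 0 ∷ 0 ∷ 0 ∷ 0 ∷ 1 ∷ [])
            , (1 , 1 ∷ [])
            , (1 , 0 ∷ 0 ∷ 0 ∷ 0 ∷ 0 ∷ 1 ∷ []) ⟧)))
        (cut (# 13) (# 3)
         (cut (# 1) (# 0)
          (leaf (# 1) ⟦ (1 , 1 ∷ [])
            , (16 , 11 ∷ 17 ∷ 112 ∷ 0 ∷ 0 ∷ 24 ∷ [])
            , (1 , 0 ∷ 0 ∷ 0 ∷ 0 ∷ 0 ∷ 0 ∷ 0 ∷ 0 ∷ 0 ∷ 0 ∷ 1728 ∷ [])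
            , (1 , 1 ∷ 0 ∷ 4 ∷ 0 ∷ 0 ∷ 0 ∷ 0 ∷ 0 ∷ 0 ∷ 0 ∷ 720 ∷ []) ⟧)
          (leaf (# 13) ⟦ (12 , 0 ∷ 3 ∷ 16 ∷ 0 ∷ 0 ∷ 0 ∷ 0 ∷ 8 ∷ [])
            , (12 , 0 ∷ 5 ∷ 8 ∷ [])
            , (1 , 1 ∷ [])
            , (1 , 0 ∷ 1 ∷ []) ⟧))
         (leaf (# 15) ⟦ (1 , 0 ∷ 2 ∷ 0 ∷ 0 ∷ 0 ∷ 0 ∷ 1 ∷ [])
           , (1 , 0 ∷ 1 ∷ [])
           , (1 , 1 ∷ [])
           , (3 , 0 ∷ 8 ∷ 0 ∷ 12 ∷ []) ⟧))))
      (cut (# 14) (# 2)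
       (cut (# 9) (# 1)
        (leaf (# 9) ⟦ (12 , 1 ∷ 0 ∷ 12 ∷ 0 ∷ 2 ∷ [])
          , (1 , 1 ∷ [])
          , (1 , 0 ∷ 0 ∷ 0 ∷ 0 ∷ 0 ∷ 0 ∷ 1728 ∷ [])
          , (2 , 1 ∷ 0 ∷ 12 ∷ []) ⟧)
        (leaf (# 14) ⟦ (4 , 0 ∷ 0 ∷ 7 ∷ 1 ∷ [])
          , (1 , 0 ∷ 0 ∷ 1 ∷ [])
          , (1 , 0 ∷ 1 ∷ [])
          , (1 , 1 ∷ []) ⟧))
       (cut (# 13) (# 3)
        (cut (# 1) (# 0)
         (leaf (# 1) ⟦ (1 , 1 ∷ [])
           , (14 , 16 ∷ 0 ∷ 41 ∷ 147 ∷ 21 ∷ [])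
           , (1 , 0 ∷ 0 ∷ 0 ∷ 0 ∷ 0 ∷ 0 ∷ 0 ∷ 0 ∷ 0 ∷ 1728 ∷ [])
           , (8 , 1 ∷ 0 ∷ 0 ∷ 48 ∷ 0 ∷ 0 ∷ 0 ∷ 4464 ∷ []) ⟧)
         (leaf (# 13) ⟦ (24 , 15 ∷ 41 ∷ 0 ∷ 42 ∷ 6 ∷ [])
           , (24 , 9 ∷ 31 ∷ 0 ∷ 24 ∷ [])
           , (1 , 1 ∷ [])
           , (1 , 0 ∷ 1 ∷ []) ⟧))
        (leaf (# 15) ⟦ (8 , 0 ∷ 5 ∷ 21 ∷ 3 ∷ [])
          , (8 , 0 ∷ 3 ∷ 12 ∷ [])
          , (1 , 1 ∷ [])
          , (1 , 0 ∷ 1 ∷ []) ⟧)))))))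

-- In the dual basis `bary r` the value at vertex `k` of facet `r` is the stored coefficient times
-- `vol r`, so nonnegativity on `r` is visible from the table.
separating : Fin 19 → Fin 19 → Row 3
separating r s = tabulate λ i →
  Σℤ λ k → + lookup (lookup (lookup separator r) s) k ℤ.* lookup (bary r k) i

Separates : Row 3 → Fin 19 → Fin 19 → Set
Separates ℓ r s =
  (∀ k → 0ℤ ℤ.< dot ℓ (tetCoord r k) ⊎
    (0ℤ ℤ.≤ dot ℓ (tetCoord r k) × ∃ λ l → tet r k ≡ tet s l)) ×
  (∀ l → dot ℓ (tetCoord s l) ℤ.≤ 0ℤ)

separates? : ∀ ℓ r s → Dec (Separates ℓ r s)
separates? ℓ r s =
  (Fin.all? λ k → (0ℤ ℤ.<? dot ℓ (tetCoord r k)) ⊎-dec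
    ((0ℤ ℤ.≤? dot ℓ (tetCoord r k)) ×-dec (Fin.any? λ l → tet r k ≟ tet s l))) ×-dec
  (Fin.all? λ l → dot ℓ (tetCoord s l) ℤ.≤? 0ℤ)

Valid : Tree → List (Row 3) → Set
Valid (leaf r cert) ctx = ∀ k → 0 ℕ.< proj₁ (lookup cert k) × (∀ j →
  + proj₁ (lookup cert k) ℤ.* lookup (bary r k) j ≡ combination (proj₂ (lookup cert k)) ctx j)
Valid (cut r k t u) ctx = Valid t (bary r k ∷ ctx) × Valid u (negate (bary r k) ∷ ctx)

valid? : ∀ t ctx → Dec (Valid t ctx)
valid? (leaf r cert) ctx = Fin.all? λ k → (0 ℕ.<? proj₁ (lookup cert k)) ×-dec (Fin.all? λ j →
  + proj₁ (lookup cert k) ℤ.* lookup (bary r k) j ℤ.≟ combination (proj₂ (lookup cert k)) ctx j)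
valid? (cut r k t u) ctx = valid? t (bary r k ∷ ctx) ×-dec valid? u (negate (bary r k) ∷ ctx)

axes : List (Row 3)
axes = ⟦ + 1 , + 0 , + 0 , + 0 ⟧ ∷ ⟦ + 0 , + 1 , + 0 , + 0 ⟧ ∷
       ⟦ + 0 , + 0 , + 1 , + 0 ⟧ ∷ ⟦ + 0 , + 0 , + 0 , + 1 ⟧ ∷ []

-- The Sperner condition forces each corner to carry its own index, so only the four interior
-- vertices are free and 256 colourings remain.
colouring : (a b c e : Fin 4) → Fin 8 → Fin 4
colouring a b c e = lookup (0F ∷ 1F ∷ 2F ∷ 3F ∷ a ∷ b ∷ c ∷ e ∷ [])

-- Finite checks by evaluation

abstract
  coord-nonneg : ∀ i j → 0ℤ ℤ.≤ lookup (coord i) j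
  coord-nonneg = toWitness {a? = Fin.all? λ i → Fin.all? λ j → 0ℤ ℤ.≤? lookup (coord i) j} tt

  coord-sum : ∀ i → Σℤ (lookup (coord i)) ≡ + 12
  coord-sum = toWitness {a? = Fin.all? λ i → Σℤ (lookup (coord i)) ℤ.≟ + 12} tt

  coord-injective : ∀ i i' → (∀ j → lookup (coord i) j ≡ lookup (coord i') j) → i ≡ i'
  coord-injective = toWitness {a? = Fin.all? λ i → Fin.all? λ i' →
    (Fin.all? λ j → lookup (coord i) j ℤ.≟ lookup (coord i') j) →-dec (i ≟ i')} tt

  coord-corner : ∀ (j : Fin 4) k → lookup (coord (j ↑ˡ 4)) k ≡ δ (+ 12) j k
  coord-corner = toWitness {a? = Fin.all? λ j → Fin.all? λ k →
    lookup (coord (j ↑ˡ 4)) k ℤ.≟ δ (+ 12) j k} tt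

  tet-used : ∀ i → ∃ λ r → ∃ λ k → tet r k ≡ i
  tet-used = toWitness {a? = Fin.all? λ i → Fin.any? λ r → Fin.any? λ k → tet r k ≟ i} tt

  tet-distinct : ∀ r s → (∀ k → ∃ λ l → tet r k ≡ tet s l) → r ≡ s
  tet-distinct = toWitness {a? = Fin.all? λ r → Fin.all? λ s →
    (Fin.all? λ k → Fin.any? λ l → tet r k ≟ tet s l) →-dec (r ≟ s)} tt

  vol-pos : ∀ r → 0ℤ ℤ.< vol r
  vol-pos = toWitness {a? = Fin.all? λ r → 0ℤ ℤ.<? vol r} tt

  bary-tet : ∀ r k l → dot (bary r k) (tetCoord r l) ≡ δ (vol r) l k
  bary-tet = toWitness {a? = Fin.all? λ r → Fin.all? λ k → Fin.all? λ l →
    dot (bary r k) (tetCoord r l) ℤ.≟ δ (vol r) l k} tt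

  -- With `bary-tet` this says that `bary r` is a two-sided adjugate of the vertex matrix. That side
  -- reads weights off a point; this side rebuilds a point from the values of its functionals.
  tet-bary : ∀ r i j → Σℤ (λ k → lookup (bary r k) i ℤ.* lookup (tetCoord r k) j) ≡ δ (vol r) i j
  tet-bary = toWitness {a? = Fin.all? λ r → Fin.all? λ i → Fin.all? λ j →
    Σℤ (λ k → lookup (bary r k) i ℤ.* lookup (tetCoord r k) j) ℤ.≟ δ (vol r) i j} tt

  separating-separates : ∀ r s → Separates (separating r s) r s
  separating-separates = toWitness {a? = Fin.all? λ r → Fin.all? λ s →
    separates? (separating r s) r s} tt

  searchTree-valid : Valid searchTree axes
  searchTree-valid = toWitness {a? = valid? searchTree axes} tt

  axes-nonneg : All (λ ℓ → ∀ j → 0ℤ ℤ.≤ lookup ℓ j) axes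
  axes-nonneg = toWitness {a? = All.all? (λ ℓ → Fin.all? λ j → 0ℤ ℤ.≤? lookup ℓ j) axes} tt

  -- When the interior tetrahedron is not rainbow, this is an instance of Sperner's lemma. What is
  -- special to this complex lies in the 24 colourings that are bijective on the interior vertices.
  colouring-rainbow : ∀ a b c e → ∃ λ s → s ≢ # 18 × Rainbow (tet s) (colouring a b c e)
  colouring-rainbow = toWitness {a? =
    Fin.all? λ a → Fin.all? λ b → Fin.all? λ c → Fin.all? λ e → Fin.any? λ s →
      ¬? (s ≟ # 18) ×-dec (Fin.all? λ k → Fin.all? λ l →
        (colouring a b c e (tet s k) ≟ colouring a b c e (tet s l)) →-dec (k ≟ l))} tt

-- Realisation of the base over the rationals

12>0 : 0ℤ ℤ.< + 12
12>0 = ℤ.+<+ (ℕ.s≤s ℕ.z≤n)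

abstract
  1/12 : ∃ λ q → 0ℚ ℚ.< q × q ℚ.* ι (+ 12) ≡ 1ℚ
  1/12 = ι-recip 12>0

ω : ℚ
ω = proj₁ 1/12

ω>0 : 0ℚ ℚ.< ω
ω>0 = proj₁ (proj₂ 1/12)

12*ω≡1 : ι (+ 12) ℚ.* ω ≡ 1ℚ
12*ω≡1 = trans (ℚ.*-comm (ι (+ 12)) ω) (proj₂ (proj₂ 1/12))

baseVert : Fin 8 → Point 3
baseVert i j = ι (lookup (coord i) j) ℚ.* ω

private
  p : Fin 19 → Fin 4 → Point 3
  p r k = baseVert (tet r k)

ι-δ-diag : ∀ z (i : Fin k) → ι (δ z i i) ≡ ι z
ι-δ-diag z i with i ≟ i
... | yes _  = refl
... | no i≢i = contradiction refl i≢i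

ι-δ-off : ∀ z {i j : Fin k} → i ≢ j → ι (δ z i j) ≡ 0ℚ
ι-δ-off z {i} {j} i≢j with i ≟ j
... | yes i≡j = contradiction i≡j i≢j
... | no _    = ι-0

ω*-pos : ∀ {z} → 0ℤ ℤ.< z → 0ℚ ℚ.< ι z ℚ.* ω
ω*-pos {z} z>0 = ℚ.positive⁻¹ (ι z ℚ.* ω)
  {{ℚ.pos*pos⇒pos (ι z) {{ℚ.positive (ι-pos z>0)}} ω {{ℚ.positive ω>0}}}}

φ-vert : ∀ ℓ i → φ ℓ (baseVert i) ≡ ι (dot ℓ (coord i)) ℚ.* ω
φ-vert ℓ i = φ-ι ℓ (coord i) ω

baryVol : Fin 19 → ℚ
baryVol r = ι (vol r) ℚ.* ω

baryVol>0 : ∀ r → 0ℚ ℚ.< baryVol r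
baryVol>0 r = ω*-pos (vol-pos r)

φ-bary-same : ∀ r k → φ (bary r k) (p r k) ≡ baryVol r
φ-bary-same r k = trans (φ-vert (bary r k) (tet r k))
  (cong (ℚ._* ω) (trans (cong ι (bary-tet r k k)) (ι-δ-diag (vol r) k)))

φ-bary-other : ∀ r {k l} → l ≢ k → φ (bary r k) (p r l) ≡ 0ℚ
φ-bary-other r {k} {l} l≢k = trans (φ-vert (bary r k) (tet r l))
  (trans (cong (ℚ._* ω) (trans (cong ι (bary-tet r k l)) (ι-δ-off (vol r) l≢k))) (ℚ.*-zeroˡ ω))

*-zeroʳ-≡ : ∀ q {x} → x ≡ 0ℚ → q ℚ.* x ≡ 0ℚ
*-zeroʳ-≡ q x≡0 = trans (cong (q ℚ.*_) x≡0) (ℚ.*-zeroʳ q)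

*-zeroˡ-≡ : ∀ {q} x → q ≡ 0ℚ → q ℚ.* x ≡ 0ℚ
*-zeroˡ-≡ x q≡0 = trans (cong (ℚ._* x) q≡0) (ℚ.*-zeroˡ x)

φ-bary-comb : ∀ r k w → φ (bary r k) (comb w (p r)) ≡ w k ℚ.* baryVol r
φ-bary-comb r k w = trans (φ-comb (bary r k) w (p r))
  (trans (Σ-single k (λ l → w l ℚ.* φ (bary r k) (p r l))
            λ l l≢k → *-zeroʳ-≡ (w l) (φ-bary-other r l≢k))
         (cong (w k ℚ.*_) (φ-bary-same r k)))

base-indep : ∀ r → LinIndep (p r)
base-indep r w vanish k = p*q≡0⇒p≡0 (baryVol>0 r)
  (trans (sym (φ-bary-comb r k w)) (Σ-0s λ j → *-zeroʳ-≡ (ι (lookup (bary r k) j)) (vanish j)))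

-- On a common point the separating functional is both ≥ 0 and ≤ 0, so it only
-- sees vertices on which it vanishes.
separated : ∀ r s {w w'} → NonNeg w → NonNeg w' → comb w (p r) ≐ comb w' (p s) →
  ∀ k → w k ≡ 0ℚ ⊎ ∃ λ l → tet r k ≡ tet s l
separated r s {w} {w'} w≥0 w'≥0 eq k =
  [ (λ pos → inj₁ (p*q≡0⇒p≡0 (subst (0ℚ ℚ.<_) (sym (φ-vert ℓ (tet r k))) (ω*-pos pos))
                     (ℚ.≤-antisym (ℚ.≤-trans (term≤Σ term≥0 k) total≤0) (term≥0 k))))
  , (λ common → inj₂ (proj₂ common)) ]′ (proj₁ (separating-separates r s) k)
  where
  ℓ = separating r s
  term : Fin 4 → ℚ
  term k = w k ℚ.* φ ℓ (p r k)
  dot≥0 : ∀ k → 0ℤ ℤ.≤ dot ℓ (tetCoord r k)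
  dot≥0 k = [ ℤ.<⇒≤ , proj₁ ]′ (proj₁ (separating-separates r s) k)
  term≥0 : ∀ k → 0ℚ ℚ.≤ term k
  term≥0 k = *-nonneg (w≥0 k) (ℚ.≤-trans (*-nonneg (ι-nonneg (dot≥0 k)) (ℚ.<⇒≤ ω>0))
    (ℚ.≤-reflexive (sym (φ-vert ℓ (tet r k)))))
  other≤0 : ∀ l → w' l ℚ.* φ ℓ (p s l) ℚ.≤ 0ℚ
  other≤0 l = ℚ.≤-trans
    (ℚ.*-monoˡ-≤-nonNeg (w' l) {{ℚ.nonNegative (w'≥0 l)}} (ℚ.≤-trans
      (ℚ.≤-reflexive (φ-vert ℓ (tet s l)))
      (ℚ.≤-trans (ℚ.*-monoʳ-≤-nonNeg ω {{ℚ.nonNegative (ℚ.<⇒≤ ω>0)}}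
                   (ι-nonpos (proj₂ (separating-separates r s) l)))
                 (ℚ.≤-reflexive (ℚ.*-zeroˡ ω)))))
    (ℚ.≤-reflexive (ℚ.*-zeroʳ (w' l)))
  total≤0 : Σℚ term ℚ.≤ 0ℚ
  total≤0 = ℚ.≤-trans
    (ℚ.≤-reflexive (trans (sym (φ-comb ℓ w (p r))) (trans (φ-cong ℓ eq) (φ-comb ℓ w' (p s)))))
    (Σ-nonpos other≤0)

tet-inj : ∀ r {k l} → tet r k ≡ tet r l → k ≡ l
tet-inj r eq = LinIndep⇒injective (base-indep r) λ j → cong (λ i → baseVert i j) eq

-- To compare weights at a shared vertex, apply `bary r k` to the common point. On facet `s`, a
-- vertex of nonzero weight also belongs to `r`, by `separated` with the facets exchanged, so the
-- functional sees only the vertex matched with `k`.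
base-meet : ∀ r s {w w'} → NonNeg w → NonNeg w' → comb w (p r) ≐ comb w' (p s) →
  ∀ k → w k ≡ 0ℚ ⊎ ∃ λ l → tet r k ≡ tet s l × w k ≡ w' l
base-meet r s {w} {w'} w≥0 w'≥0 eq k =
  [ inj₁ , (λ { (l , kl) → inj₂ (l , kl , *-cancelʳ-pos (baryVol>0 r) (weights l kl)) }) ]′
  (separated r s w≥0 w'≥0 eq k)
  where
  open ≡-Reasoning
  module _ (l : Fin 4) (kl : tet r k ≡ tet s l) where
    vanish : ∀ l' → l' ≢ l → w' l' ℚ.* φ (bary r k) (p s l') ≡ 0ℚ
    vanish l' l'≢l =
      [ *-zeroˡ-≡ (φ (bary r k) (p s l'))
      , (λ { (k' , l'k') → *-zeroʳ-≡ (w' l')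
             (trans (cong (λ i → φ (bary r k) (baseVert i)) l'k')
                    (φ-bary-other r λ k'≡k → l'≢l (tet-inj s
                      (trans l'k' (trans (cong (tet r) k'≡k) kl))))) }) ]′
      (separated s r w'≥0 w≥0 (sym ∘ eq) l')
    weights : w k ℚ.* baryVol r ≡ w' l ℚ.* baryVol r
    weights = begin
      w k ℚ.* baryVol r
        ≡⟨ φ-bary-comb r k w ⟨
      φ (bary r k) (comb w (p r))
        ≡⟨ φ-cong (bary r k) eq ⟩
      φ (bary r k) (comb w' (p s))
        ≡⟨ φ-comb (bary r k) w' (p s) ⟩
      Σℚ (λ l → w' l ℚ.* φ (bary r k) (p s l))
        ≡⟨ Σ-single l (λ l → w' l ℚ.* φ (bary r k) (p s l)) vanish ⟩
      w' l ℚ.* φ (bary r k) (p s l)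
        ≡⟨ cong (w' l ℚ.*_) (trans (cong (λ i → φ (bary r k) (baseVert i)) (sym kl))
                                   (φ-bary-same r k)) ⟩
      w' l ℚ.* baryVol r ∎

search : ∀ t {ctx} → Valid t ctx → (x : Point 3) → All (λ ℓ → 0ℚ ℚ.≤ φ ℓ x) ctx →
  ∃ λ r → ∀ k → 0ℚ ℚ.≤ φ (bary r k) x
search (leaf r cert) {ctx} valid x ctx≥0 = r , λ k →
  ℚ.*-cancelˡ-≤-pos (c k) {{ℚ.positive (ι-pos (ℤ.+<+ (proj₁ (valid k))))}}
    (ℚ.≤-trans (ℚ.≤-reflexive (ℚ.*-zeroʳ (c k)))
      (ℚ.≤-trans (combination-nonneg (proj₂ (lookup cert k)) x ctx≥0)
                 (ℚ.≤-reflexive (scaled k))))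
  where
  c : Fin 4 → ℚ
  c k = ι (+ proj₁ (lookup cert k))
  scaled : ∀ k → Σℚ (λ j → ι (combination (proj₂ (lookup cert k)) ctx j) ℚ.* x j) ≡
    c k ℚ.* φ (bary r k) x
  scaled k = trans
    (Σ-cong λ j → trans (cong (ℚ._* x j) (trans (cong ι (sym (proj₂ (valid k) j)))
                           (ι-* (+ proj₁ (lookup cert k)) (lookup (bary r k) j))))
                        (ℚ.*-assoc (c k) (ι (lookup (bary r k) j)) (x j)))
    (Σ-*ˡ (c k) (λ j → ι (lookup (bary r k) j) ℚ.* x j))
search (cut r k t u) (valid-t , valid-u) x ctx≥0 =
  [ (λ 0≤φ → search t valid-t x (0≤φ ∷ ctx≥0))
  , (λ φ≤0 → search u valid-u x
      (ℚ.≤-trans (ℚ.neg-antimono-≤ φ≤0) (ℚ.≤-reflexive (sym (φ-negate (bary r k) x))) ∷ ctx≥0))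
  ]′ (ℚ.≤-total 0ℚ (φ (bary r k) x))

base-cover : ∀ x → NonNeg x → ∃ λ r → ∃ λ w → NonNeg w × comb w (p r) ≐ x
base-cover x x≥0 = reconstruct (search searchTree searchTree-valid x
    (All.map (λ {ℓ} ℓ≥0 → Σ-nonneg {f = λ j → ι (lookup ℓ j) ℚ.* x j}
                            λ j → *-nonneg (ι-nonneg (ℓ≥0 j)) (x≥0 j)) axes-nonneg))
  where
  reconstruct : (∃ λ r → ∀ k → 0ℚ ℚ.≤ φ (bary r k) x) →
    ∃ λ r → ∃ λ w → NonNeg w × comb w (p r) ≐ x
  reconstruct (r , φ≥0) = r , w , w≥0 , recover
    where
    q : ∃ λ q → 0ℚ ℚ.< q × q ℚ.* ι (vol r) ≡ 1ℚ
    q = ι-recip (vol-pos r)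
    -- Dividing by `vol r` normalises the adjugate; the factor 12 undoes the scaling by `ω` in
    -- `baseVert`.
    κ : ℚ
    κ = proj₁ q ℚ.* ι (+ 12)
    κ≥0 : 0ℚ ℚ.≤ κ
    κ≥0 = *-nonneg (ℚ.<⇒≤ (proj₁ (proj₂ q))) (ι-nonneg (ℤ.<⇒≤ 12>0))
    w : Fin 4 → ℚ
    w k = φ (bary r k) x ℚ.* κ
    w≥0 : NonNeg w
    w≥0 k = *-nonneg (φ≥0 k) κ≥0
    κω : κ ℚ.* ω ≡ proj₁ q
    κω = trans (ℚ.*-assoc (proj₁ q) (ι (+ 12)) ω)
      (trans (cong (proj₁ q ℚ.*_) 12*ω≡1) (ℚ.*-identityʳ (proj₁ q)))
    module _ (j : Fin 4) where
      b z : Fin 4 → Fin 4 → ℚ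
      b k i = ι (lookup (bary r k) i)
      z k i = ι (lookup (tetCoord r k) i)
      column : ∀ i → Σℚ (λ k → b k i ℚ.* z k j) ≡ ι (δ (vol r) i j)
      column i = trans (Σ-cong λ k → sym (ι-* (lookup (bary r k) i) (lookup (tetCoord r k) j)))
        (trans (sym (ι-Σ λ k → lookup (bary r k) i ℤ.* lookup (tetCoord r k) j))
               (cong ι (tet-bary r i j)))
      recover : comb w (p r) j ≡ x j
      recover = begin
        Σℚ (λ k → w k ℚ.* (z k j ℚ.* ω))
          ≡⟨ Σ-cong (λ k → trans
               (solve 4 (λ f κ z ω → (f :* κ) :* (z :* ω) := (κ :* ω) :* (z :* f)) refl
                  (φ (bary r k) x) κ (z k j) ω)
               (cong (κ ℚ.* ω ℚ.*_) (sym (Σ-*ˡ (z k j) (λ i → b k i ℚ.* x i))))) ⟩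
        Σℚ (λ k → κ ℚ.* ω ℚ.* Σℚ (λ i → z k j ℚ.* (b k i ℚ.* x i)))
          ≡⟨ Σ-*ˡ (κ ℚ.* ω) (λ k → Σℚ (λ i → z k j ℚ.* (b k i ℚ.* x i))) ⟩
        κ ℚ.* ω ℚ.* Σℚ (λ k → Σℚ (λ i → z k j ℚ.* (b k i ℚ.* x i)))
          ≡⟨ cong₂ ℚ._*_ κω (Σ-swap (λ k i → z k j ℚ.* (b k i ℚ.* x i))) ⟩
        proj₁ q ℚ.* Σℚ (λ i → Σℚ (λ k → z k j ℚ.* (b k i ℚ.* x i)))
          ≡⟨ cong (proj₁ q ℚ.*_) (Σ-cong λ i → trans
               (Σ-cong λ k → solve 3 (λ z b x → z :* (b :* x) := (b :* z) :* x) refl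
                               (z k j) (b k i) (x i))
               (trans (Σ-*ʳ (λ k → b k i ℚ.* z k j) (x i)) (cong (ℚ._* x i) (column i)))) ⟩
        proj₁ q ℚ.* Σℚ (λ i → ι (δ (vol r) i j) ℚ.* x i)
          ≡⟨ cong (proj₁ q ℚ.*_) (Σ-single j (λ i → ι (δ (vol r) i j) ℚ.* x i)
               λ i i≢j → *-zeroˡ-≡ (x i) (ι-δ-off (vol r) i≢j)) ⟩
        proj₁ q ℚ.* (ι (δ (vol r) j j) ℚ.* x j)
          ≡⟨ cong (λ v → proj₁ q ℚ.* (v ℚ.* x j)) (ι-δ-diag (vol r) j) ⟩
        proj₁ q ℚ.* (ι (vol r) ℚ.* x j)
          ≡⟨ ℚ.*-assoc (proj₁ q) (ι (vol r)) (x j) ⟨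
        proj₁ q ℚ.* ι (vol r) ℚ.* x j
          ≡⟨ cong (ℚ._* x j) (proj₂ (proj₂ q)) ⟩
        1ℚ ℚ.* x j
          ≡⟨ ℚ.*-identityˡ (x j) ⟩
        x j ∎
        where open ≡-Reasoning; open +-*-Solver

base-corner : ∀ j → baseVert (j ↑ˡ 4) ≐ corner j
base-corner j k = trans (cong (λ z → ι z ℚ.* ω) (coord-corner j k)) (at (j ≟ k))
  where
  at : Dec (j ≡ k) → ι (δ (+ 12) j k) ℚ.* ω ≡ corner j k
  at (yes refl) = trans (cong (ℚ._* ω) (ι-δ-diag (+ 12) j)) (trans 12*ω≡1 (sym (corner-same j)))
  at (no j≢k)   = trans (*-zeroˡ-≡ ω (ι-δ-off (+ 12) j≢k)) (sym (corner-other j≢k))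

base : Fan 3 8 19
base .vert  = baseVert
base .facet = tet
base .vert-in i = (λ j → *-nonneg (ι-nonneg (coord-nonneg i j)) (ℚ.<⇒≤ ω>0)) ,
  trans (Σ-*ʳ (λ j → ι (lookup (coord i) j)) ω)
    (trans (cong (ℚ._* ω) (trans (sym (ι-Σ (lookup (coord i)))) (cong ι (coord-sum i)))) 12*ω≡1)
base .vert-inj i i' eq = coord-injective i i' λ j → ι-injective (*-cancelʳ-pos ω>0 (eq j))
base .vert-used = tet-used
base .corners j = j ↑ˡ 4 , base-corner j
base .indep = base-indep
base .distinct = tet-distinct
base .meet = base-meet
base .cover = base-cover

base-NeverAlone : NeverAlone base (# 18)
base-NeverAlone c sperner = s , s≢18 , λ k l eq →
  rainbow k l (trans (sym (recolour (tet s k))) (trans eq (recolour (tet s l))))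
  where
  found : ∃ λ s → s ≢ # 18 × Rainbow (tet s) (colouring (c 4F) (c 5F) (c 6F) (c 7F))
  found = colouring-rainbow (c 4F) (c 5F) (c 6F) (c 7F)
  s : Fin 19
  s = proj₁ found
  s≢18 : s ≢ # 18
  s≢18 = proj₁ (proj₂ found)
  rainbow : Rainbow (tet s) (colouring (c 4F) (c 5F) (c 6F) (c 7F))
  rainbow = proj₂ (proj₂ found)
  corner-colour : ∀ j → c (j ↑ˡ 4) ≡ j
  -- Corner `j` lies on every face of the simplex except the one with index `j`.
  corner-colour j = decidable-stable (c (j ↑ˡ 4) ≟ j) λ c≢j →
    sperner (j ↑ˡ 4) (c (j ↑ˡ 4))
      (trans (base-corner j (c (j ↑ˡ 4))) (corner-other (c≢j ∘ sym))) refl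
  recolour : ∀ i → c i ≡ colouring (c 4F) (c 5F) (c 6F) (c 7F) i
  recolour 0F = corner-colour 0F
  recolour 1F = corner-colour 1F
  recolour 2F = corner-colour 2F
  recolour 3F = corner-colour 3F
  recolour 4F = refl
  recolour 5F = refl
  recolour 6F = refl
  recolour 7F = refl

-- Assembly in all dimensions and sizes

record Gadget (d N : ℕ) : Set where
  field
    {n′ m′}     : ℕ
    fan         : Fan d n′ (suc m′)
    large       : N ≤ n′
    -- The facet meant is `suc bad`, which keeps it apart from facet zero, the one that `stack`
    -- subdivides.
    bad         : Fin m′
    never-alone : NeverAlone fan (suc bad)

open Gadget

coneGadget : Gadget d 0 → Gadget (suc d) 0
coneGadget g = record
  { fan = cone (fan g) ; large = z≤n ; bad = bad g
  ; never-alone = cone-NeverAlone (fan g) (suc (bad g)) (never-alone g) }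

stackGadget : ∀ {N} → Gadget (suc d) N → Gadget (suc d) (suc N)
stackGadget g = record
  -- Since the new facets come first, the index of the surviving bad facet is again a successor,
  -- which determines the omitted value and lets stacking be repeated.
  { fan = stack (fan g) ; large = s≤s (large g) ; bad = _
  ; never-alone = stack-NeverAlone (fan g) (bad g) (never-alone g) }

gadget₀ : ∀ e → Gadget (3 + e) 0
-- The successor of 17 is 18, the index of the interior tetrahedron.
gadget₀ zero    = record { fan = base ; large = z≤n ; bad = # 17 ; never-alone = base-NeverAlone }
gadget₀ (suc e) = coneGadget (gadget₀ e)

gadget : ∀ e N → Gadget (3 + e) N
gadget e zero    = gadget₀ e
gadget e (suc N) = stackGadget (gadget e N)

theorem3p4 : ∀ (d : ℕ) → 3 ≤ d → ∀ (N : ℕ) →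
    ∃ λ (K : Triangulation d) → N ≤ Triangulation.n K × ¬ Critical G[ K ] (d + 2)
theorem3p4 _ (s≤s (s≤s (s≤s {n = e} z≤n))) N = triangulation (fan g) , large g ,
  NeverAlone⇒¬Critical (fan g) (suc (bad g)) (never-alone g)
  where
  g : Gadget (3 + e) N
  g = gadget e N
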